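{- Let $a_0,a_1,b_0,b_1$ be positive integers and let $c_i=\min\{a_i,b_i\}$ for $i=0,1$. Let $\mathcal M=\mathcal P\times_{\mathcal L}\mathcal Q$ be the fiber product of the $a_0\times a_1$ Clements--Lindström poset $\mathcal P$ and the $b_0\times b_1$ Clements--Lindström poset $\mathcal Q$ over the $c_0\times c_1$ Clements--Lindström poset $\mathcal L$ (included in $\mathcal P$ and $\mathcal Q$ by the identity on exponent vectors). Then $\mathcal M$ is Macaulay if and only if any one of the following holds: (1) $a_0\le b_0$ and $a_1\le b_1$; (2) $b_0\le a_0$ and $b_1\le a_1$; (3) $b_0<a_0$ and $a_1<b_1$ and at least one of: (a) $a_0=b_1$; (b) $b_1<a_0$ and $b_1+b_0\le a_0+a_1$; (c) $a_0<b_1$ and $a_0+a_1\le b_0+b_1$; (4) $a_0<b_0$ and $b_1<a_1$ and at least one of: (a) $b_0=a_1$; (b) $a_1<b_0$ and $a_1+a_0\le b_0+b_1$; (c) $b_0<a_1$ and $b_0+b_1\le a_0+a_1$.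
   Context: For positive integers $d_0,d_1$, the $d_0\times d_1$ Clements--Lindström poset is $\{(i,j)\in\mathbb N^2: i<d_0,\ j<d_1\}$ with componentwise order, ranked by $i+j$. Given rank-preserving inclusions of posets $\iota_A:\mathcal P_C\hookrightarrow\mathcal P_A$, $\iota_B:\mathcal P_C\hookrightarrow\mathcal P_B$, the fiber product $\mathcal P_A\times_{\mathcal P_C}\mathcal P_B$ is the union of $\mathcal P_A$ and $\mathcal P_B$ with the two copies of $\mathcal P_C$ identified, with order relations induced from $\mathcal P_A$ and $\mathcal P_B$. In the present case $\mathcal M$ is the set of $(i,j)\in\mathbb N^2$ with ($i<a_0$ and $j<a_1$) or ($i<b_0$ and $j<b_1$), under componentwise order, ranked by $i+j$. For a ranked poset $\mathcal R$, $\mathcal R_{[d]}$ is the set of elements of rank $d$; for $A\subseteq\mathcal R$ the upper shadow is $\nabla A=\{b: b\text{ covers some }a\in A\}$. Given an additional total order on $\mathcal R$ (not required to be related to the partial order), $\mathrm{Seg}_d\,q$ denotes the set of the $q$ largest elements of $\mathcal R_{[d]}$ in the total order. $\mathcal R$ is Macaulay if there is a total order on $\mathcal R$ such that for every $d$ and every $A\subseteq\mathcal R_{[d]}$: (i) $|\nabla\mathrm{Seg}_d|A||\le|\nabla A|$, and (ii) $\nabla\mathrm{Seg}_d|A|=\mathrm{Seg}_{d+1}|\nabla\mathrm{Seg}_d|A||$. -}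

module Defs where

open import Data.Irrelevant using ([_])
open import Data.List.Base using (List; []; _∷_; map; mapMaybe; filter; length; take; upTo; cartesianProduct)
open import Data.List.Membership.Propositional using (_∈_)
open import Data.List.Membership.Propositional.Properties
  using (∈-map⁻; ∈-filter⁺; ∈-cartesianProduct⁺; ∈-upTo⁺)
open import Data.List.Relation.Binary.BagAndSetEquality using (_∼[_]_; set)
open import Data.List.Relation.Unary.All as All using (All; all?)
open import Data.List.Relation.Unary.Any using (any?)
open import Data.List.Relation.Unary.Unique.Propositional using (Unique)
import Data.List.Relation.Unary.Unique.Propositional.Properties as Unique
import Data.List.Sort as Sort
open import Data.Maybe.Base using (Maybe; just; nothing)
open import Data.Nat.Base using (ℕ; suc; _+_; _⊓_; _⊔_; _≤_; _<_)
import Data.Nat.Properties as ℕ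
open import Data.Product.Base using (_×_; _,_; proj₁; proj₂; ∃; ∃-syntax)
open import Data.Product.Properties using (≡-dec)
open import Data.Refinement using (Refinement; _,_; value; value-injective) renaming (_≟_ to refinement-≟)
open import Data.Sum.Base using (inj₁; inj₂; [_,_]′)
open import Function.Base using (_∘_)
open import Level using (0ℓ)
open import Relation.Binary.Bundles using (DecTotalOrder)
open import Relation.Binary.Construct.Flip.EqAndOrd using (decTotalOrder)
open import Relation.Binary.Core using (Rel)
open import Relation.Binary.Definitions using (DecidableEquality) renaming (Decidable to Decidable₂)
open import Relation.Binary.PropositionalEquality using (_≡_; _≢_; refl; sym; cong; cong₂; subst; isEquivalence)
open import Relation.Binary.Structures using (IsDecPartialOrder; IsDecTotalOrder)
open import Relation.Nullary.Decidable using (yes; no; ¬?; _×-dec_; map′; recompute)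
open import Relation.Nullary.Negation using (¬_; contradiction)
open import Relation.Unary using (Pred; Decidable; _∩_; _∪_; _≐_)
open import Relation.Unary.Properties using (_∪?_)

record FiniteRankedPoset : Set₁ where
  infix 4 _⊑_ _⊏_ _⋖_
  field
    Carrier           : Set
    _⊑_               : Rel Carrier 0ℓ
    isDecPartialOrder : IsDecPartialOrder _≡_ _⊑_
    elements          : List Carrier
    elements-unique   : Unique elements
    elements-complete : ∀ x → x ∈ elements
    rank              : Carrier → ℕ

  open IsDecPartialOrder isDecPartialOrder public using (_≟_) renaming (_≤?_ to _⊑?_)

  _⊏_ : Rel Carrier 0ℓ
  x ⊏ y = x ⊑ y × x ≢ y

  _⋖_ : Rel Carrier 0ℓ
  x ⋖ y = x ⊏ y × (∀ z → ¬ (x ⊏ z × z ⊏ y))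

  field
    rank-⋖ : ∀ {x y} → x ⋖ y → rank y ≡ suc (rank x)

  _⊏?_ : Decidable₂ _⊏_
  x ⊏? y = (x ⊑? y) ×-dec ¬? (x ≟ y)

  _⋖?_ : Decidable₂ _⋖_
  x ⋖? y = (x ⊏? y) ×-dec
    map′ (λ h z → All.lookup h (elements-complete z)) (λ h → All.tabulate (λ {z} _ → h z))
         (all? (λ z → ¬? ((x ⊏? z) ×-dec (z ⊏? y))) elements)

  level : ℕ → List Carrier
  level d = filter (λ x → rank x ℕ.≟ d) elements

  ∇ : List Carrier → List Carrier
  ∇ A = filter (λ b → any? (λ a → a ⋖? b) A) elements

-- Finite subsets are duplicate-free lists, compared as sets by _∼[ set ]_, so that
-- cardinality is length (level, ∇ and Seg are duplicate-free by construction).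
module _ (R : FiniteRankedPoset) where
  open FiniteRankedPoset R

  descending : {_≼_ : Rel Carrier 0ℓ} → IsDecTotalOrder _≡_ _≼_ → DecTotalOrder 0ℓ 0ℓ 0ℓ
  descending isDTO = decTotalOrder (record { isDecTotalOrder = isDTO })

  -- Sorting along the flipped order lists the level from largest to smallest.
  Seg : {_≼_ : Rel Carrier 0ℓ} → IsDecTotalOrder _≡_ _≼_ → ℕ → ℕ → List Carrier
  Seg isDTO d q = take q (Sort.sort (descending isDTO) (level d))

  IsMacaulayOrder : {_≼_ : Rel Carrier 0ℓ} → IsDecTotalOrder _≡_ _≼_ → Set
  IsMacaulayOrder isDTO =
    ∀ d (A : List Carrier) → Unique A → All (λ x → rank x ≡ d) A →
      length (∇ (Seg isDTO d (length A))) ≤ length (∇ A)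
      × (∇ (Seg isDTO d (length A))
           ∼[ set ] Seg isDTO (suc d) (length (∇ (Seg isDTO d (length A)))))

  -- A total order with decidable equality is decidable, so asking for
  -- IsDecTotalOrder rather than IsTotalOrder loses no orders.
  Macaulay : Set₁
  Macaulay = ∃[ _≼_ ] ∃ (IsMacaulayOrder {_≼_})

infix 4 _≤²_
_≤²_ : Rel (ℕ × ℕ) 0ℓ
(i , j) ≤² (k , l) = i ≤ k × j ≤ l

_≟²_ : DecidableEquality (ℕ × ℕ)
_≟²_ = ≡-dec ℕ._≟_ ℕ._≟_

record FiniteOrderIdeal : Set₁ where
  field
    Mem         : Pred (ℕ × ℕ) 0ℓ
    mem?        : Decidable Mem
    down-closed : ∀ {x y} → x ≤² y → Mem y → Mem x
    n₀ n₁       : ℕ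
    bounded     : ∀ {i j} → Mem (i , j) → i < n₀ × j < n₁

open FiniteOrderIdeal

module _ (X : FiniteOrderIdeal) where
  private
    Point : Set
    Point = Refinement (ℕ × ℕ) (Mem X)

    member : (v : Point) → Mem X (value v)
    member (x , [ m ]) = recompute (mem? X x) m

    pack : ℕ × ℕ → Maybe Point
    pack x with mem? X x
    ... | yes m = just (x , [ m ])
    ... | no  _ = nothing

    grid : List (ℕ × ℕ)
    grid = cartesianProduct (upTo (n₀ X)) (upTo (n₁ X))

    points : List Point
    points = mapMaybe pack grid

    map-value-pack : ∀ xs → map value (mapMaybe pack xs) ≡ filter (mem? X) xs
    map-value-pack [] = refl
    map-value-pack (x ∷ xs) with mem? X x
    ... | yes _ = cong (x ∷_) (map-value-pack xs)
    ... | no  _ = map-value-pack xs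

    points-unique : Unique points
    points-unique = Unique.map⁻ (subst Unique (sym (map-value-pack grid))
      (Unique.filter⁺ (mem? X)
        (Unique.cartesianProduct⁺ (Unique.upTo⁺ (n₀ X)) (Unique.upTo⁺ (n₁ X)))))

    points-complete : ∀ v → v ∈ points
    points-complete v =
      let m         = member v
          i< , j<   = bounded X m
          v∈filter  = ∈-filter⁺ (mem? X) (∈-cartesianProduct⁺ (∈-upTo⁺ i<) (∈-upTo⁺ j<)) m
          w , w∈ , eq = ∈-map⁻ value (subst (value v ∈_) (sym (map-value-pack grid)) v∈filter)
      in subst (_∈ points) (sym (value-injective eq)) w∈

    infix 4 _⊑_
    _⊑_ : Rel Point 0ℓ
    v ⊑ w = value v ≤² value w

    isDecPartialOrder : IsDecPartialOrder _≡_ _⊑_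
    isDecPartialOrder = record
      { isPartialOrder = record
        { isPreorder = record
          { isEquivalence = isEquivalence
          ; reflexive     = λ { refl → ℕ.≤-refl , ℕ.≤-refl }
          ; trans         = λ (p , q) (r , s) → ℕ.≤-trans p r , ℕ.≤-trans q s
          }
        ; antisym = λ (p , q) (r , s) →
            value-injective (cong₂ _,_ (ℕ.≤-antisym p r) (ℕ.≤-antisym q s))
        }
      ; _≟_  = refinement-≟ _≟²_
      ; _≤?_ = λ v w → (proj₁ (value v) ℕ.≤? proj₁ (value w))
                       ×-dec (proj₂ (value v) ℕ.≤? proj₂ (value w))
      }

    rank : Point → ℕ
    rank v = proj₁ (value v) + proj₂ (value v)

    -- Between x and any larger y lies x plus a unit vector.
    covers-value : ∀ (v w : Point) →
                   (v ⊑ w × v ≢ w) →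
                   (∀ u → ¬ ((v ⊑ u × v ≢ u) × (u ⊑ w × u ≢ w))) →
                   rank w ≡ suc (rank v)
    covers-value v@((i , j) , _) w@((k , l) , _) ((i≤k , j≤l) , v≢w) gap with i ℕ.<? k
    ... | yes i<k with ((suc i , j) ≟² (k , l))
    ...   | yes refl = refl
    ...   | no  ≢w   = contradiction
            (((ℕ.n≤1+n i , ℕ.≤-refl) , λ e → ℕ.1+n≢n (sym (cong (proj₁ ∘ value) e)))
            , ((i<k , j≤l) , ≢w ∘ cong value))
            (gap ((suc i , j) , [ down-closed X (i<k , j≤l) (member w) ]))
    covers-value v@((i , j) , _) w@((k , l) , _) ((i≤k , j≤l) , v≢w) gap | no i≮k with j ℕ.<? l
    ... | no j≮l   = contradiction
            (value-injective (cong₂ _,_ (ℕ.≤-antisym i≤k (ℕ.≮⇒≥ i≮k)) (ℕ.≤-antisym j≤l (ℕ.≮⇒≥ j≮l))))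
            v≢w
    ... | yes j<l with ((i , suc j) ≟² (k , l))
    ...   | yes refl = ℕ.+-suc i j
    ...   | no  ≢w   = contradiction
            (((ℕ.≤-refl , ℕ.n≤1+n j) , λ e → ℕ.1+n≢n (sym (cong (proj₂ ∘ value) e)))
            , ((i≤k , j<l) , ≢w ∘ cong value))
            (gap ((i , suc j) , [ down-closed X (i≤k , j<l) (member w) ]))

  toRankedPoset : FiniteRankedPoset
  toRankedPoset = record
    { Carrier           = Point
    ; _⊑_               = _⊑_
    ; isDecPartialOrder = isDecPartialOrder
    ; elements          = points
    ; elements-unique   = points-unique
    ; elements-complete = points-complete
    ; rank              = rank
    ; rank-⋖            = λ {v} {w} (v⊏w , gap) → covers-value v w v⊏w gap
    }

clementsLindström : ℕ → ℕ → FiniteOrderIdeal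
clementsLindström d₀ d₁ = record
  { Mem         = λ (i , j) → i < d₀ × j < d₁
  ; mem?        = λ (i , j) → (i ℕ.<? d₀) ×-dec (j ℕ.<? d₁)
  ; down-closed = λ (i≤k , j≤l) (k< , l<) → ℕ.≤-<-trans i≤k k< , ℕ.≤-<-trans j≤l l<
  ; n₀          = d₀
  ; n₁          = d₁
  ; bounded     = λ m → m
  }

-- When P and Q meet exactly in L, identifying their two copies of L gives P ∪ Q
-- inside ℕ². As P and Q are down-closed, x ≤² y with y in P (or Q) forces x into
-- the same part, so the componentwise order on P ∪ Q is the union of the orders
-- of P and Q.
fiberProduct : (P Q L : FiniteOrderIdeal) → (Mem P ∩ Mem Q) ≐ Mem L → FiniteOrderIdeal
fiberProduct P Q L _ = record
  { Mem         = Mem P ∪ Mem Q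
  ; mem?        = mem? P ∪? mem? Q
  ; down-closed = λ x≤y → [ inj₁ ∘ down-closed P x≤y , inj₂ ∘ down-closed Q x≤y ]′
  ; n₀          = n₀ P ⊔ n₀ Q
  ; n₁          = n₁ P ⊔ n₁ Q
  ; bounded     = [ (λ m → let i< , j< = bounded P m in
                        ℕ.<-≤-trans i< (ℕ.m≤m⊔n _ _) , ℕ.<-≤-trans j< (ℕ.m≤m⊔n _ _))
                  , (λ m → let i< , j< = bounded Q m in
                        ℕ.<-≤-trans i< (ℕ.m≤n⊔m _ _) , ℕ.<-≤-trans j< (ℕ.m≤n⊔m _ _)) ]′
  }

clementsLindström-∩ : ∀ a₀ a₁ b₀ b₁ →
  (Mem (clementsLindström a₀ a₁) ∩ Mem (clementsLindström b₀ b₁))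
    ≐ Mem (clementsLindström (a₀ ⊓ b₀) (a₁ ⊓ b₁))
clementsLindström-∩ a₀ a₁ b₀ b₁ =
    (λ ((i<a , j<a) , (i<b , j<b)) → ℕ.⊓-pres-m< i<a i<b , ℕ.⊓-pres-m< j<a j<b)
  , (λ (i< , j<) →
        (ℕ.m<n⊓o⇒m<n a₀ b₀ i< , ℕ.m<n⊓o⇒m<n a₁ b₁ j<)
      , (ℕ.m<n⊓o⇒m<o a₀ b₀ i< , ℕ.m<n⊓o⇒m<o a₁ b₁ j<))

{-# OPTIONS --safe #-}

-- On a level of M a point is determined by x₀, and its upper neighbours sit at x₀ and
-- x₀ + 1, so consecutive levels form disjoint paths. On a path a set can only shrink in the
-- shadow if it contains all of a part whose two ends are both walls, and then only by 1.
-- From rank b₀ + a₁ - 1 on there are two such parts, those of P and Q, closing up in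
-- ranks a₀ - 1 and b₁ - 1 respectively. If Q closes up first (b₁ ≤ a₀), optimal segments
-- must start with Q; this is compatible with the final ranks, where both parts are closed
-- and the smaller one has to come first, iff b₀ + b₁ ≤ a₀ + a₁. Transposing the plane
-- handles the case that P closes up first.
module Submission where

open import Defs
open import Data.Nat using (ℕ; NonZero; _+_; _⊓_; _≤_; _<_)
open import Data.Product using (_×_)
open import Data.Sum using (_⊎_)
open import Function.Bundles using (_⇔_)
open import Relation.Binary.PropositionalEquality using (_≡_)

open import Data.Empty using (⊥)
open import Data.Irrelevant using ([_])
open import Data.List.Base using (List; []; _∷_; _++_; length; take; drop; filter; map)
open import Data.List.Membership.Propositional using (_∈_; _∉_; find; lose)
open import Data.List.Membership.Propositional.Properties
  using (∈-∃++; ∈-++⁺ˡ; ∈-++⁺ʳ; ∈-++⁻; ∈-filter⁺; ∈-filter⁻; ∈-map⁺)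
open import Data.List.Properties using (length-++-sucʳ; length-take; length-map; take++drop≡id)
open import Data.List.Relation.Binary.BagAndSetEquality using (_∼[_]_; set)
open import Data.List.Relation.Binary.Permutation.Propositional using (↭-sym; ↭⇒↭ₛ)
open import Data.List.Relation.Binary.Permutation.Propositional.Properties using (∈-resp-↭; ↭-length)
open import Data.List.Relation.Binary.Permutation.Setoid.Properties using (Unique-resp-↭)
import Data.List.Relation.Unary.All as All
open import Data.List.Relation.Unary.AllPairs using (AllPairs; []; _∷_)
open import Data.List.Relation.Unary.Any using (here; there; any?)
open import Data.List.Relation.Unary.Sorted.TotalOrder.Properties using (Sorted⇒AllPairs)
open import Data.List.Relation.Unary.Unique.Propositional using (Unique)
import Data.List.Relation.Unary.Unique.Propositional.Properties as Unique
import Data.List.Sort as Sort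
open import Data.Maybe.Base using (Maybe; just; nothing)
open import Data.Nat.Base using (zero; suc; _∸_; z≤n; s≤s; s≤s⁻¹; z<s; >-nonZero⁻¹)
import Data.Nat.Properties as ℕ
open import Data.Nat.Properties hiding (_≟_)
open import Data.Nat.Tactic.RingSolver using (solve)
open import Data.Product using (∃; _,_; proj₁; proj₂)
open import Data.Product.Relation.Binary.Lex.NonStrict using (×-Lex; ×-isDecTotalOrder)
open import Data.Product.Relation.Binary.Pointwise.NonDependent using (Pointwise)
open import Data.Refinement using (_,_; value; value-injective)
open import Data.Sum using (inj₁; inj₂; [_,_]′; swap)
open import Data.Unit using (⊤; tt)
open import Function.Base using (_∘_; id)
open import Function.Bundles using (mk⇔; Equivalence)
open import Level using (0ℓ)
open import Relation.Binary.Bundles using (DecTotalOrder)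
open import Relation.Binary.Core using (Rel)
open import Relation.Binary.Definitions using (tri<; tri≈; tri>)
open import Relation.Binary.PropositionalEquality
  using (_≢_; refl; sym; trans; cong; cong₂; subst; setoid; isEquivalence; module ≡-Reasoning)
open import Relation.Binary.Structures using (IsDecTotalOrder)
open import Relation.Nullary using (Dec; yes; no; ¬_; ¬?; contradiction)
open import Relation.Nullary.Decidable using (_×-dec_; _⊎-dec_; decidable-stable; recompute)

-- Optimality is a comparison of two bounds. For an arbitrary set `A`, a matching of `A` into its
-- shadow bounds `∇ A` from below; a `Routing` records it as a choice of right or up at each point.
-- For a segment, an injection of the shadow back into the segment bounds it from above. The
-- inequality `b₀ + b₁ ≤ a₀ + a₁` compares sizes: once both parts are separate and closed, rank `d`
-- has `b₀ + b₁ - 1 - d` points in Q and `a₀ + a₁ - 1 - d` in P, as long as these numbers are not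
-- negative. When the inequality fails, the decisive rank is `a₀ - 2`, the last one where P is still
-- open. Condition (i) forces segments to begin with points of Q there, and condition (ii) carries
-- this to a rank where (i) forces the opposite.

private
  variable
    A B : Set

-- Counting by injections

mutual
  -- A relation rather than a function, so that the image may depend on a membership proof. The
  -- image of the head is the value that the tail must miss, so the weak and the strict version
  -- recurse through each other.
  injection⇒length-≤ : (_~_ : A → B → Set) {xs : List A} (ys : List B) → Unique xs →
    (∀ {x} → x ∈ xs → ∃ λ y → y ∈ ys × x ~ y) →
    (∀ {x x′ y} → x ∈ xs → x′ ∈ xs → x ~ y → x′ ~ y → x ≡ x′) →
    length xs ≤ length ys
  injection⇒length-≤ _~_ ys [] _ _ = z≤n
  injection⇒length-≤ _~_ ys (x∉xs ∷ xs!) total injective with total (here refl)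
  ... | y , y∈ys , x~y = injection⇒length-< _~_ ys xs! y∈ys
    (λ x′∈xs → let y′ , y′∈ys , x′~y′ = total (there x′∈xs) in
      y′ , y′∈ys , x′~y′ , λ { refl →
        All.lookup x∉xs x′∈xs (injective (here refl) (there x′∈xs) x~y x′~y′) })
    (λ x∈ x′∈ → injective (there x∈) (there x′∈))

  injection⇒length-< : (_~_ : A → B → Set) {xs : List A} (ys : List B) {y₀ : B} → Unique xs → y₀ ∈ ys →
    (∀ {x} → x ∈ xs → ∃ λ y → y ∈ ys × x ~ y × y ≢ y₀) →
    (∀ {x x′ y} → x ∈ xs → x′ ∈ xs → x ~ y → x′ ~ y → x ≡ x′) →
    length xs < length ys
  injection⇒length-< _~_ ys {y₀} xs! y₀∈ys total injective with ∈-∃++ y₀∈ys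
  ... | before , after , refl = ≤-trans
    (s≤s (injection⇒length-≤ _~_ (before ++ after) xs!
      (λ x∈xs → let y , y∈ys , x~y , y≢y₀ = total x∈xs in
        y , without y∈ys y≢y₀ , x~y)
      injective))
    (≤-reflexive (sym (length-++-sucʳ before y₀ after)))
    where
    without : ∀ {y} → y ∈ before ++ y₀ ∷ after → y ≢ y₀ → y ∈ before ++ after
    without y∈ y≢y₀ with ∈-++⁻ before y∈
    ... | inj₁ y∈before         = ∈-++⁺ˡ y∈before
    ... | inj₂ (here y≡y₀)      = contradiction y≡y₀ y≢y₀
    ... | inj₂ (there y∈after)  = ∈-++⁺ʳ before y∈after

⊆⇒length-≤ : {xs ys : List A} → Unique xs → (∀ {x} → x ∈ xs → x ∈ ys) → length xs ≤ length ys
⊆⇒length-≤ xs! xs⊆ys = injection⇒length-≤ _≡_ _ xs! (λ x∈xs → _ , xs⊆ys x∈xs , refl) λ { _ _ refl refl → refl }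

⊂⇒length-< : {xs ys : List A} {y : A} → Unique xs → (∀ {x} → x ∈ xs → x ∈ ys) → y ∈ ys → y ∉ xs →
             length xs < length ys
⊂⇒length-< xs! xs⊆ys y∈ys y∉xs = injection⇒length-< _≡_ _ xs! y∈ys
  (λ x∈xs → _ , xs⊆ys x∈xs , refl , λ { refl → y∉xs x∈xs }) λ { _ _ refl refl → refl }

-- Levels and shadows in an arbitrary ranked poset

module Shadow (R : FiniteRankedPoset) where
  open FiniteRankedPoset R
  open import Data.List.Membership.DecPropositional _≟_ public using (_∈?_)

  Subset : ℕ → List Carrier → Set
  Subset d A = Unique A × (∀ {x} → x ∈ A → rank x ≡ d)

  ∈-level⁺ : ∀ {d x} → rank x ≡ d → x ∈ level d
  ∈-level⁺ = ∈-filter⁺ (λ x → rank x ℕ.≟ _) (elements-complete _)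

  ∈-level⁻ : ∀ {d x} → x ∈ level d → rank x ≡ d
  ∈-level⁻ = proj₂ ∘ ∈-filter⁻ (λ x → rank x ℕ.≟ _) {xs = elements}

  level-Subset : ∀ d → Subset d (level d)
  level-Subset d = Unique.filter⁺ _ elements-unique , ∈-level⁻

  filter-Subset : ∀ {d} {P : Carrier → Set} (P? : ∀ x → Dec (P x)) → Subset d (filter P? (level d))
  filter-Subset P? = Unique.filter⁺ P? (proj₁ (level-Subset _)) , ∈-level⁻ ∘ proj₁ ∘ ∈-filter⁻ P? {xs = level _}

  Subset⇒length-≤ : ∀ {d A} → Subset d A → length A ≤ length (level d)
  Subset⇒length-≤ (A! , rankA) = ⊆⇒length-≤ A! (∈-level⁺ ∘ rankA)

  ∈-∇⁺ : ∀ {A x y} → x ∈ A → x ⋖ y → y ∈ ∇ A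
  ∈-∇⁺ x∈A x⋖y = ∈-filter⁺ _ (elements-complete _) (lose x∈A x⋖y)

  ∈-∇⁻ : ∀ {A y} → y ∈ ∇ A → ∃ λ x → x ∈ A × x ⋖ y
  ∈-∇⁻ {A} = find ∘ proj₂ ∘ ∈-filter⁻ _ {xs = elements}

  ∇-Subset : ∀ {d A} → Subset d A → Subset (suc d) (∇ A)
  ∇-Subset (A! , rankA) = Unique.filter⁺ _ elements-unique ,
    λ y∈ → let x , x∈A , x⋖y = ∈-∇⁻ y∈ in trans (rank-⋖ x⋖y) (cong suc (rankA x∈A))

  ∇-mono : ∀ {A B} → (∀ {x} → x ∈ A → x ∈ B) → ∀ {y} → y ∈ ∇ A → y ∈ ∇ B
  ∇-mono A⊆B y∈ = let x , x∈A , x⋖y = ∈-∇⁻ y∈ in ∈-∇⁺ (A⊆B x∈A) x⋖y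

  length-∇-mono : ∀ {A B} → (∀ {x} → x ∈ A → x ∈ B) → length (∇ A) ≤ length (∇ B)
  length-∇-mono A⊆B = ⊆⇒length-≤ (Unique.filter⁺ _ elements-unique) (∇-mono A⊆B)

-- Segments as up-closed subsets of a level

module Segment (R : FiniteRankedPoset)
  {_≼_ : Rel (FiniteRankedPoset.Carrier R) 0ℓ} (isDTO : IsDecTotalOrder _≡_ _≼_) where
  open FiniteRankedPoset R
  open Shadow R
  private
    module ≼ = IsDecTotalOrder isDTO

    O : DecTotalOrder 0ℓ 0ℓ 0ℓ
    O = descending R isDTO

    sorted : ℕ → List Carrier
    sorted d = Sort.sort O (level d)

    sorted-unique : ∀ d → Unique (sorted d)
    sorted-unique d = Unique-resp-↭ (setoid Carrier) (↭⇒↭ₛ (↭-sym (Sort.sort-↭ O (level d)))) (proj₁ (level-Subset d))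

    ∈-sorted⁻ : ∀ {d x} → x ∈ sorted d → rank x ≡ d
    ∈-sorted⁻ {d} = ∈-level⁻ ∘ ∈-resp-↭ (Sort.sort-↭ O (level d))

    ∈-sorted⁺ : ∀ {d x} → rank x ≡ d → x ∈ sorted d
    ∈-sorted⁺ {d} = ∈-resp-↭ (↭-sym (Sort.sort-↭ O (level d))) ∘ ∈-level⁺

    take∪drop : ∀ q {d x} → rank x ≡ d → x ∈ take q (sorted d) ⊎ x ∈ drop q (sorted d)
    take∪drop q {d} rx = ∈-++⁻ (take q (sorted d)) (subst (_ ∈_) (sym (take++drop≡id q (sorted d))) (∈-sorted⁺ rx))

    split-AllPairs : ∀ {S : Rel Carrier 0ℓ} q xs → AllPairs S xs → ∀ {x y} → x ∈ take q xs → y ∈ drop q xs → S x y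
    split-AllPairs (suc q) (x ∷ xs) (x~ ∷ _) (here refl) y∈ = All.lookup x~ (drop-⊆ q xs y∈)
      where
      drop-⊆ : ∀ q (xs : List Carrier) {y} → y ∈ drop q xs → y ∈ xs
      drop-⊆ q xs = subst (_ ∈_) (take++drop≡id q xs) ∘ ∈-++⁺ʳ (take q xs)
    split-AllPairs (suc q) (_ ∷ xs) (_ ∷ ps) (there x∈) y∈ = split-AllPairs q xs ps x∈ y∈

  UpClosed : ℕ → List Carrier → Set
  UpClosed d S = ∀ {x y} → x ∈ S → rank y ≡ d → x ≼ y → y ∈ S

  Seg-Subset : ∀ d q → Subset d (Seg R isDTO d q)
  Seg-Subset d q = Unique.take⁺ q (sorted-unique d) ,
    λ x∈ → ∈-sorted⁻ (subst (_ ∈_) (take++drop≡id q (sorted d)) (∈-++⁺ˡ x∈))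

  Seg-length : ∀ d q → q ≤ length (level d) → length (Seg R isDTO d q) ≡ q
  Seg-length d q q≤ = trans (length-take q (sorted d))
    (m≤n⇒m⊓n≡m (≤-trans q≤ (≤-reflexive (sym (↭-length (Sort.sort-↭ O (level d)))))))

  Seg-upClosed : ∀ d q → UpClosed d (Seg R isDTO d q)
  Seg-upClosed d q {x} {y} x∈ ry x≼y with take∪drop q ry
  ... | inj₁ y∈ = y∈
  ... | inj₂ y∈ = subst (_∈ Seg R isDTO d q) (≼.antisym x≼y y≼x) x∈
    where
    y≼x : y ≼ x
    y≼x = split-AllPairs q (sorted d) (Sorted⇒AllPairs (DecTotalOrder.totalOrder O) (Sort.sort-↗ O (level d))) x∈ y∈

  -- By totality two up-closed subsets of a level are nested, and lengths decide which way. Hence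
  -- up-closedness and length determine a segment, and sorting need not be mentioned again.
  upClosed-⊆ : ∀ {d S S′} → Subset d S → Subset d S′ → UpClosed d S → UpClosed d S′ →
               length S ≤ length S′ → ∀ {x} → x ∈ S → x ∈ S′
  upClosed-⊆ {S = S} {S′} (_ , rankS) (S′! , rankS′) upS upS′ S≤S′ {x} x∈S with x ∈? S′
  ... | yes x∈S′ = x∈S′
  ... | no  x∉S′ = contradiction S≤S′ (<⇒≱ (⊂⇒length-< S′! S′⊆S x∈S x∉S′))
    where
    S′⊆S : ∀ {y} → y ∈ S′ → y ∈ S
    S′⊆S {y} y∈S′ with ≼.total x y
    ... | inj₁ x≼y = upS x∈S (rankS′ y∈S′) x≼y
    ... | inj₂ y≼x = contradiction (upS′ y∈S′ (rankS x∈S) y≼x) x∉S′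

  upClosed⇒Seg : ∀ {d S} → Subset d S → UpClosed d S → S ∼[ set ] Seg R isDTO d (length S)
  upClosed⇒Seg {d} {S} S⊆ upS = mk⇔
    (upClosed-⊆ S⊆ (Seg-Subset d _) upS (Seg-upClosed d _) (≤-reflexive (sym len)))
    (upClosed-⊆ (Seg-Subset d _) S⊆ (Seg-upClosed d _) upS (≤-reflexive len))
    where
    len : length (Seg R isDTO d (length S)) ≡ length S
    len = Seg-length d _ (Subset⇒length-≤ S⊆)

-- Farkas certificate: y - x is b - a plus a natural number k.
linear : ∀ {x y a b} k → a ≤ b → y + a ≡ x + b + k → x ≤ y
linear {x} {y} {a} {b} k a≤b e = +-cancelʳ-≤ a x y (begin
  x + a      ≤⟨ +-monoʳ-≤ x a≤b ⟩
  x + b      ≤⟨ m≤m+n (x + b) k ⟩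
  x + b + k  ≡⟨ sym e ⟩
  y + a      ∎)
  where open ≤-Reasoning

equal-sums-< : ∀ {i j k l} → i + j ≡ k + l → i < k → l < j
equal-sums-< {i} {j} {k} {l} e i<k = linear 0 (+-mono-≤ i<k (≤-reflexive (sym e))) (solve (i ∷ j ∷ k ∷ l ∷ []))

-- Coordinates on the poset and their symmetries

Region : (a₀ a₁ b₀ b₁ i j : ℕ) → Set
Region a₀ a₁ b₀ b₁ i j = (i < a₀ × j < a₁) ⊎ (i < b₀ × j < b₁)

-- The poset stays fixed and only its coordinates vary: a symmetry is a second set of coordinates on
-- the same `R`, so `Macaulay R` is never transported along an isomorphism.
record Realizes (R : FiniteRankedPoset) (a₀ a₁ b₀ b₁ : ℕ) : Set where
  open FiniteRankedPoset R
  field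
    x₀ x₁            : Carrier → ℕ
    coords-injective : ∀ {v w} → x₀ v ≡ x₀ w → x₁ v ≡ x₁ w → v ≡ w
    region           : ∀ v → Region a₀ a₁ b₀ b₁ (x₀ v) (x₁ v)
    point            : ∀ {i j} → Region a₀ a₁ b₀ b₁ i j → ∃ λ v → x₀ v ≡ i × x₁ v ≡ j
    ⊑⁺               : ∀ {v w} → x₀ v ≤ x₀ w → x₁ v ≤ x₁ w → v ⊑ w
    ⊑⁻               : ∀ {v w} → v ⊑ w → x₀ v ≤ x₀ w × x₁ v ≤ x₁ w
    rank-sum         : ∀ v → rank v ≡ x₀ v + x₁ v

-- The reflected Q takes the place of P. The shape `b₀ ≤ a₀`, `a₁ ≤ b₁` is thereby preserved, while
-- the order in which the parts close is reversed.
transpose : ∀ {R a₀ a₁ b₀ b₁} → Realizes R a₀ a₁ b₀ b₁ → Realizes R b₁ b₀ a₁ a₀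
transpose real = record
  { x₀               = x₁
  ; x₁               = x₀
  ; coords-injective = λ e₁ e₀ → coords-injective e₀ e₁
  ; region           = λ v → flip-region (region v)
  ; point            = λ r → let v , e₀ , e₁ = point (flip-region r) in v , e₁ , e₀
  ; ⊑⁺               = λ p q → ⊑⁺ q p
  ; ⊑⁻               = λ v⊑w → let p , q = ⊑⁻ v⊑w in q , p
  ; rank-sum         = λ v → trans (rank-sum v) (+-comm (x₀ v) (x₁ v))
  }
  where
  open Realizes real
  flip-region : ∀ {a₀ a₁ b₀ b₁ i j} → Region a₀ a₁ b₀ b₁ i j → Region b₁ b₀ a₁ a₀ j i
  flip-region (inj₁ (p , q)) = inj₂ (q , p)
  flip-region (inj₂ (p , q)) = inj₁ (q , p)

exchange : ∀ {R a₀ a₁ b₀ b₁} → Realizes R a₀ a₁ b₀ b₁ → Realizes R b₀ b₁ a₀ a₁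
exchange real = record
  { Realizes real
  ; region = λ v → swap (region v)
  ; point  = λ r → point (swap r)
  }
  where open Realizes real

-- Covers, and matchings of a set into its shadow

module Grid {R : FiniteRankedPoset} {a₀ a₁ b₀ b₁ : ℕ} (real : Realizes R a₀ a₁ b₀ b₁) where
  open FiniteRankedPoset R
  open Shadow R
  open Realizes real

  InM : ℕ → ℕ → Set
  InM = Region a₀ a₁ b₀ b₁

  down-closed : ∀ {i j k l} → i ≤ k → j ≤ l → InM k l → InM i j
  down-closed i≤k j≤l (inj₁ (k< , l<)) = inj₁ (≤-<-trans i≤k k< , ≤-<-trans j≤l l<)
  down-closed i≤k j≤l (inj₂ (k< , l<)) = inj₂ (≤-<-trans i≤k k< , ≤-<-trans j≤l l<)

  sum : ∀ {d v} → rank v ≡ d → x₀ v + x₁ v ≡ d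
  sum r = trans (sym (rank-sum _)) r

  same-rank : ∀ {d v w} → rank v ≡ d → rank w ≡ d → x₀ v + x₁ v ≡ x₀ w + x₁ w
  same-rank rv rw = trans (sum rv) (sym (sum rw))

  x₀-determines : ∀ {d v w} → rank v ≡ d → rank w ≡ d → x₀ v ≡ x₀ w → v ≡ w
  x₀-determines {v = v} {w} rv rw e = coords-injective e
    (+-cancelˡ-≡ (x₀ v) (x₁ v) (x₁ w) (trans (same-rank rv rw) (cong (_+ x₁ w) (sym e))))

  x₁-determines : ∀ {d v w} → rank v ≡ d → rank w ≡ d → x₁ v ≡ x₁ w → v ≡ w
  x₁-determines {v = v} {w} rv rw e = coords-injective
    (+-cancelʳ-≡ (x₁ v) (x₀ v) (x₀ w) (trans (same-rank rv rw) (cong (x₀ w +_) (sym e)))) e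

  Right Up : Carrier → Carrier → Set
  Right v w = x₀ w ≡ suc (x₀ v) × x₁ w ≡ x₁ v
  Up    v w = x₀ w ≡ x₀ v × x₁ w ≡ suc (x₁ v)

  private
    between : ∀ {m k} → m ≤ k → k ≤ suc m → m ≡ k ⊎ k ≡ suc m
    between m≤k k≤1+m with m≤n⇒m<n∨m≡n m≤k
    ... | inj₁ m<k = inj₂ (≤-antisym k≤1+m m<k)
    ... | inj₂ m≡k = inj₁ m≡k

  right⇒⋖ : ∀ {v w} → Right v w → v ⋖ w
  right⇒⋖ {v} {w} (e₀ , e₁) =
    (⊑⁺ (subst (x₀ v ≤_) (sym e₀) (n≤1+n _)) (≤-reflexive (sym e₁)) , λ { refl → 1+n≢n (sym e₀) }) ,
    λ z ((v⊑z , v≢z) , (z⊑w , z≢w)) →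
      let p , q = ⊑⁻ v⊑z
          r , s = ⊑⁻ z⊑w
          z₁≡v₁ = ≤-antisym (subst (x₁ z ≤_) e₁ s) q
      in [ (λ e → v≢z (coords-injective e (sym z₁≡v₁)))
         , (λ e → z≢w (coords-injective (trans e (sym e₀)) (trans z₁≡v₁ (sym e₁)))) ]′
         (between p (subst (x₀ z ≤_) e₀ r))

  up⇒⋖ : ∀ {v w} → Up v w → v ⋖ w
  up⇒⋖ {v} {w} (e₀ , e₁) =
    (⊑⁺ (≤-reflexive (sym e₀)) (subst (x₁ v ≤_) (sym e₁) (n≤1+n _)) , λ { refl → 1+n≢n (sym e₁) }) ,
    λ z ((v⊑z , v≢z) , (z⊑w , z≢w)) →
      let p , q = ⊑⁻ v⊑z
          r , s = ⊑⁻ z⊑w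
          z₀≡v₀ = ≤-antisym (subst (x₀ z ≤_) e₀ r) p
      in [ (λ e → v≢z (coords-injective (sym z₀≡v₀) e))
         , (λ e → z≢w (coords-injective (trans z₀≡v₀ (sym e₀)) (trans e (sym e₁)))) ]′
         (between q (subst (x₁ z ≤_) e₁ s))

  ⋖⇒right⊎up : ∀ {v w} → v ⋖ w → Right v w ⊎ Up v w
  ⋖⇒right⊎up {v} {w} v⋖w@((v⊑w , _) , _) with ⊑⁻ v⊑w
  ... | p , q = go p q (trans (sym (rank-sum w)) (trans (rank-⋖ v⋖w) (cong suc (rank-sum v))))
    where
    go : ∀ {i j k l} → i ≤ k → j ≤ l → k + l ≡ suc (i + j) → (k ≡ suc i × l ≡ j) ⊎ (k ≡ i × l ≡ suc j)
    go {i} {j} {k} {l} i≤k j≤l e with m≤n⇒m<n∨m≡n i≤k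
    ... | inj₂ refl = inj₂ (refl , +-cancelˡ-≡ i l (suc j) (trans e (sym (+-suc i j))))
    ... | inj₁ i<k with ≤-antisym k≤1+i i<k
      where
      k≤1+i : k ≤ suc i
      k≤1+i = linear 0 (+-mono-≤ j≤l (≤-reflexive e)) (solve (i ∷ j ∷ k ∷ l ∷ []))
    ...   | refl = inj₁ (refl , +-cancelˡ-≡ i l j (suc-injective e))

  -- A routing sends each x ∈ S to one of its upper neighbours; neighbours on a level
  -- share exactly one, and compatibility keeps them from both being sent there.
  record Routing (S : Carrier → Set) : Set₁ where
    field
      GoesRight  : Carrier → Set
      goesRight? : ∀ v → Dec (GoesRight v)
      right      : ∀ {v} → S v → GoesRight v → InM (suc (x₀ v)) (x₁ v)
      up         : ∀ {v} → S v → ¬ GoesRight v → InM (x₀ v) (suc (x₁ v))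
      compatible : ∀ {v w} → S v → S w → x₀ w ≡ suc (x₀ v) → x₁ v ≡ suc (x₁ w) → GoesRight v → GoesRight w

  restrict : ∀ {S S′ : Carrier → Set} → (∀ {v} → S′ v → S v) → Routing S → Routing S′
  restrict S′⊆S r = record
    { GoesRight  = GoesRight
    ; goesRight? = goesRight?
    ; right      = right ∘ S′⊆S
    ; up         = up ∘ S′⊆S
    ; compatible = λ v w → compatible (S′⊆S v) (S′⊆S w)
    }
    where open Routing r

  -- Two points can collide only if the left one goes right and the right one goes up, which
  -- `compatible` excludes.
  routing⇒length-≤ : ∀ {A} → Unique A → Routing (_∈ A) → length A ≤ length (∇ A)
  routing⇒length-≤ {A} A! r = injection⇒length-≤ _~_ (∇ A) A! total injective
    where
    open Routing r
    _~_ : Carrier → Carrier → Set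
    v ~ w = (GoesRight v × Right v w) ⊎ (¬ GoesRight v × Up v w)

    total : ∀ {v} → v ∈ A → ∃ λ w → w ∈ ∇ A × v ~ w
    total {v} v∈A with goesRight? v
    ... | yes g = let w , e = point (right v∈A g) in w , ∈-∇⁺ v∈A (right⇒⋖ e) , inj₁ (g , e)
    ... | no ¬g = let w , e = point (up v∈A ¬g) in w , ∈-∇⁺ v∈A (up⇒⋖ e) , inj₂ (¬g , e)

    injective : ∀ {v v′ w} → v ∈ A → v′ ∈ A → v ~ w → v′ ~ w → v ≡ v′
    injective _ _ (inj₁ (_ , e₀ , e₁)) (inj₁ (_ , f₀ , f₁)) =
      coords-injective (suc-injective (trans (sym e₀) f₀)) (trans (sym e₁) f₁)
    injective _ _ (inj₂ (_ , e₀ , e₁)) (inj₂ (_ , f₀ , f₁)) =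
      coords-injective (trans (sym e₀) f₀) (suc-injective (trans (sym e₁) f₁))
    injective v∈ v′∈ (inj₁ (g , e₀ , e₁)) (inj₂ (¬g , f₀ , f₁)) =
      contradiction (compatible v∈ v′∈ (trans (sym f₀) e₀) (trans (sym e₁) f₁) g) ¬g
    injective v∈ v′∈ (inj₂ (¬g , f₀ , f₁)) (inj₁ (g , e₀ , e₁)) =
      contradiction (compatible v′∈ v∈ (trans (sym f₀) e₀) (trans (sym e₁) f₁) g) ¬g

  routing-off⇒length-≤ : ∀ {A} m → Unique A → Routing (λ v → v ∈ A × v ≢ m) → length A ≤ suc (length (∇ A))
  routing-off⇒length-≤ {A} m A! r = begin
    length A             ≤⟨ ⊆⇒length-≤ A! A⊆m∷A′ ⟩
    suc (length A′)      ≤⟨ s≤s (routing⇒length-≤ (Unique.filter⁺ _ A!) (restrict ∈A′⁻ r)) ⟩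
    suc (length (∇ A′))  ≤⟨ s≤s (length-∇-mono (proj₁ ∘ ∈A′⁻)) ⟩
    suc (length (∇ A))   ∎
    where
    open ≤-Reasoning
    A′ : List Carrier
    A′ = filter (λ v → ¬? (v ≟ m)) A

    ∈A′⁻ : ∀ {v} → v ∈ A′ → v ∈ A × v ≢ m
    ∈A′⁻ = ∈-filter⁻ (λ v → ¬? (v ≟ m)) {xs = A}

    A⊆m∷A′ : ∀ {v} → v ∈ A → v ∈ m ∷ A′
    A⊆m∷A′ {v} v∈A with v ≟ m
    ... | yes v≡m = here v≡m
    ... | no  v≢m = there (∈-filter⁺ _ v∈A v≢m)

  -- Points before m go right and points after m go up: a set missing m does not shrink.
  routing-around : ∀ {d} {S : Carrier → Set} m → rank m ≡ d →
    (∀ {v} → S v → rank v ≡ d × v ≢ m) →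
    (∀ {v} → S v → x₀ v < x₀ m → x₁ m < x₁ v → InM (suc (x₀ v)) (x₁ v)) →
    (∀ {v} → S v → x₀ m < x₀ v → x₁ v < x₁ m → InM (x₀ v) (suc (x₁ v))) →
    Routing S
  routing-around {d} {S} m rm S⊆ right-valid up-valid = record
    { GoesRight  = λ v → x₀ v < x₀ m
    ; goesRight? = λ v → x₀ v <? x₀ m
    ; right      = λ Sv v<m → right-valid Sv v<m (equal-sums-< (same-rank (proj₁ (S⊆ Sv)) rm) v<m)
    ; up         = λ Sv v≮m → let m<v = after Sv v≮m in
                     up-valid Sv m<v (equal-sums-< (same-rank rm (proj₁ (S⊆ Sv))) m<v)
    ; compatible = λ _ Sw e _ v<m → ≤∧≢⇒< (subst (_≤ x₀ m) (sym e) v<m) (off Sw)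
    }
    where
    off : ∀ {v} → S v → x₀ v ≢ x₀ m
    off Sv e = let rv , v≢m = S⊆ Sv in v≢m (x₀-determines rv rm e)

    after : ∀ {v} → S v → ¬ x₀ v < x₀ m → x₀ m < x₀ v
    after Sv v≮m = ≤∧≢⇒< (≮⇒≥ v≮m) (off Sv ∘ sym)

  routing-up : ∀ {S : Carrier → Set} → (∀ {v} → S v → InM (x₀ v) (suc (x₁ v))) → Routing S
  routing-up valid = record
    { GoesRight  = λ _ → ⊥
    ; goesRight? = λ _ → no id
    ; right      = λ _ ()
    ; up         = λ Sv _ → valid Sv
    ; compatible = λ _ _ _ _ ()
    }

  routing-right : ∀ {S : Carrier → Set} → (∀ {v} → S v → InM (suc (x₀ v)) (x₁ v)) → Routing S
  routing-right valid = record
    { GoesRight  = λ _ → ⊤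
    ; goesRight? = λ _ → yes tt
    ; right      = λ Sv _ → valid Sv
    ; up         = λ _ ¬⊤ → contradiction tt ¬⊤
    ; compatible = λ _ _ _ _ _ → tt
    }

  search : ∀ {P : Carrier → Set} → (∀ v → Dec (P v)) → ∀ d →
           (∃ λ v → rank v ≡ d × P v) ⊎ (∀ v → rank v ≡ d → ¬ P v)
  search P? d with any? P? (level d)
  ... | yes found = let v , v∈ , Pv = find found in inj₁ (v , ∈-level⁻ v∈ , Pv)
  ... | no  none  = inj₂ λ v rv Pv → none (lose (∈-level⁺ rv) Pv)

  point-at : ∀ {d i j} → InM i j → i + j ≡ d → ∃ λ v → rank v ≡ d × x₀ v ≡ i × x₁ v ≡ j
  point-at r i+j≡d = let v , e₀ , e₁ = point r in
    v , trans (rank-sum v) (trans (cong₂ _+_ e₀ e₁) i+j≡d) , e₀ , e₁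

  left : ∀ {d v} → rank v ≡ suc d → 0 < x₀ v → ∃ λ w → rank w ≡ d × Right w v
  left {d} {v} rv 0<v₀ = go (x₀ v) refl 0<v₀
    where
    go : ∀ i → i ≡ x₀ v → 0 < i → ∃ λ w → rank w ≡ d × Right w v
    go (suc i) e _ =
      let w , rw , e₀ , e₁ = point-at (down-closed (≤-trans (n≤1+n i) (≤-reflexive e)) ≤-refl (region v))
                               (suc-injective (trans (cong (_+ x₁ v) e) (sum rv)))
      in w , rw , trans (sym e) (cong suc (sym e₀)) , sym e₁

  below : ∀ {d v} → rank v ≡ suc d → 0 < x₁ v → ∃ λ w → rank w ≡ d × Up w v
  below {d} {v} rv 0<v₁ = go (x₁ v) refl 0<v₁
    where
    go : ∀ j → j ≡ x₁ v → 0 < j → ∃ λ w → rank w ≡ d × Up w v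
    go (suc j) e _ =
      let w , rw , e₀ , e₁ = point-at (down-closed ≤-refl (≤-trans (n≤1+n j) (≤-reflexive e)) (region v))
                               (suc-injective (trans (sym (+-suc (x₀ v) j)) (trans (cong (x₀ v +_) e) (sum rv))))
      in w , rw , sym e₀ , trans (sym e) (cong suc (sym e₁))

-- The L-shaped region and its split into two parts

module Crossing {R : FiniteRankedPoset} {a₀ a₁ b₀ b₁ : ℕ} (real : Realizes R a₀ a₁ b₀ b₁)
  (b₀≤a₀ : b₀ ≤ a₀) (a₁≤b₁ : a₁ ≤ b₁) where
  open FiniteRankedPoset R
  open Shadow R
  open Realizes real
  open Grid real

  x₁<b₁ : ∀ v → x₁ v < b₁
  x₁<b₁ v with region v
  ... | inj₁ (_ , v₁<a₁) = <-≤-trans v₁<a₁ a₁≤b₁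
  ... | inj₂ (_ , v₁<b₁) = v₁<b₁

  x₀<a₀ : ∀ v → x₀ v < a₀
  x₀<a₀ v with region v
  ... | inj₁ (v₀<a₀ , _) = v₀<a₀
  ... | inj₂ (v₀<b₀ , _) = <-≤-trans v₀<b₀ b₀≤a₀

  x₀<b₀ : ∀ v → a₁ ≤ x₁ v → x₀ v < b₀
  x₀<b₀ v a₁≤v₁ with region v
  ... | inj₁ (_ , v₁<a₁) = contradiction v₁<a₁ (≤⇒≯ a₁≤v₁)
  ... | inj₂ (v₀<b₀ , _) = v₀<b₀

  -- A point of the `a₀` by `b₁` box outside M lies above `(b₀ , a₁)`, so in smaller ranks M agrees
  -- with the box.
  inM-below-corner : ∀ {i j} → i < a₀ → j < b₁ → i + j < b₀ + a₁ → InM i j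
  inM-below-corner {i} {j} i<a₀ j<b₁ i+j< with i <? b₀
  ... | yes i<b₀ = inj₂ (i<b₀ , j<b₁)
  ... | no  i≮b₀ = inj₁ (i<a₀ , linear 0 (+-mono-≤ (≮⇒≥ i≮b₀) i+j<) (solve (i ∷ j ∷ b₀ ∷ a₁ ∷ [])))

  x₀-pos : ∀ {d} v → rank v ≡ d → b₁ ≤ d → 0 < x₀ v
  x₀-pos v rv b₁≤d = go (x₀ v) (x₁ v) (sum rv) (x₁<b₁ v)
    where
    go : ∀ i j → i + j ≡ _ → j < b₁ → 0 < i
    go zero    j refl j<b₁ = contradiction j<b₁ (≤⇒≯ b₁≤d)
    go (suc i) j _    _    = z<s

  left-neighbour : ∀ {d} v → rank v ≡ suc d → b₁ ≤ suc d → ∃ λ w → rank w ≡ d × Right w v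
  left-neighbour v rv b₁≤ = left rv (x₀-pos v rv b₁≤)

  routing-around-single : ∀ {d} {S : Carrier → Set} m → rank m ≡ d → suc d < b₀ + a₁ →
    (∀ {v} → S v → rank v ≡ d × v ≢ m) → Routing S
  routing-around-single m rm below S⊆ = routing-around m rm S⊆
    (λ {v} Sv v<m _ → inM-below-corner (≤-<-trans v<m (x₀<a₀ m)) (x₁<b₁ v)
      (subst (_< b₀ + a₁) (cong suc (sym (sum (proj₁ (S⊆ Sv))))) below))
    (λ {v} Sv _ v<m → inM-below-corner (x₀<a₀ v) (≤-<-trans v<m (x₁<b₁ m))
      (subst (_< b₀ + a₁) (trans (cong suc (sym (sum (proj₁ (S⊆ Sv))))) (sym (+-suc (x₀ v) (x₁ v)))) below))

  -- From rank b₀ + a₁ - 1 on, the part x₁ ≥ a₁ (from Q) and the part x₁ < a₁ (from P)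
  -- have disjoint upper shadows.
  module TwoParts {d : ℕ} (corner : b₀ + a₁ ≤ suc d) where

    -- Neighbours on the two sides of the split could meet only at a point with `x₀ ≥ b₀` and
    -- `x₁ ≥ a₁`, which is not in M. Routings of the two parts can therefore be chosen
    -- independently.
    combine : ∀ {S : Carrier → Set} → (∀ {v} → S v → rank v ≡ d) →
      Routing (λ v → S v × a₁ ≤ x₁ v) → Routing (λ v → S v × x₁ v < a₁) → Routing S
    combine {S} S⊆ rQ rP = record
      { GoesRight  = λ v → (a₁ ≤ x₁ v × Q.GoesRight v) ⊎ (x₁ v < a₁ × P.GoesRight v)
      ; goesRight? = λ v → ((a₁ ≤? x₁ v) ×-dec Q.goesRight? v) ⊎-dec ((x₁ v <? a₁) ×-dec P.goesRight? v)
      ; right      = λ { Sv (inj₁ (v∈Q , g)) → Q.right (Sv , v∈Q) g ; Sv (inj₂ (v∈P , g)) → P.right (Sv , v∈P) g }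
      ; up         = λ {v} Sv ¬g → up-valid (x₁ v <? a₁) Sv ¬g
      ; compatible = λ {v} {w} Sv Sw e₀ e₁ g → compat (x₁ w <? a₁) Sv Sw e₀ e₁ g
      }
      where
      module Q = Routing rQ
      module P = Routing rP

      up-valid : ∀ {v} → Dec (x₁ v < a₁) → S v → ¬ ((a₁ ≤ x₁ v × Q.GoesRight v) ⊎ (x₁ v < a₁ × P.GoesRight v)) →
                 InM (x₀ v) (suc (x₁ v))
      up-valid (yes v∈P) Sv ¬g = P.up (Sv , v∈P) λ g → ¬g (inj₂ (v∈P , g))
      up-valid (no  v∉P) Sv ¬g = Q.up (Sv , ≮⇒≥ v∉P) λ g → ¬g (inj₁ (≮⇒≥ v∉P , g))

      corner-gap : ∀ {i j} → i + suc j ≡ d → j < a₁ → b₀ ≤ suc i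
      corner-gap {i} {j} e j<a₁ = linear 0 (+-mono-≤ corner (+-mono-≤ j<a₁ (≤-reflexive (sym e))))
        (solve (i ∷ j ∷ d ∷ a₁ ∷ b₀ ∷ []))

      compat : ∀ {v w} → Dec (x₁ w < a₁) → S v → S w → x₀ w ≡ suc (x₀ v) → x₁ v ≡ suc (x₁ w) →
        (a₁ ≤ x₁ v × Q.GoesRight v) ⊎ (x₁ v < a₁ × P.GoesRight v) →
        (a₁ ≤ x₁ w × Q.GoesRight w) ⊎ (x₁ w < a₁ × P.GoesRight w)
      compat (yes w∈P) Sv Sw e₀ e₁ (inj₂ (v∈P , g)) = inj₂ (w∈P , P.compatible (Sv , v∈P) (Sw , w∈P) e₀ e₁ g)
      compat (no  w∉P) Sv Sw e₀ e₁ (inj₁ (v∈Q , g)) = inj₁ (≮⇒≥ w∉P , Q.compatible (Sv , v∈Q) (Sw , ≮⇒≥ w∉P) e₀ e₁ g)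
      compat (no  w∉P) Sv Sw e₀ e₁ (inj₂ (v∈P , _)) =
        contradiction (≤-<-trans (n≤1+n _) (subst (_< a₁) e₁ v∈P)) w∉P
      compat {v} {w} (yes w∈P) Sv Sw e₀ e₁ (inj₁ (v∈Q , g)) with Q.right (Sv , v∈Q) g
      ... | inj₁ (_ , v₁<a₁)   = contradiction v₁<a₁ (≤⇒≯ v∈Q)
      ... | inj₂ (1+v₀<b₀ , _) = contradiction 1+v₀<b₀ (≤⇒≯
        (corner-gap (trans (cong (x₀ v +_) (sym e₁)) (sum (S⊆ Sv))) w∈P))

    routing-around-Q : ∀ {S : Carrier → Set} m → rank m ≡ d → a₁ ≤ x₁ m →
      (∀ {v} → S v → rank v ≡ d × v ≢ m) → Routing (λ v → S v × a₁ ≤ x₁ v)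
    routing-around-Q m rm m∈Q S⊆ = routing-around m rm (S⊆ ∘ proj₁)
      (λ {v} _ v<m _ → inj₂ (≤-<-trans v<m (x₀<b₀ m m∈Q) , x₁<b₁ v))
      (λ {v} (_ , v∈Q) _ v<m → inj₂ (x₀<b₀ v v∈Q , ≤-<-trans v<m (x₁<b₁ m)))

    routing-around-P : ∀ {S : Carrier → Set} m → rank m ≡ d → x₁ m < a₁ →
      (∀ {v} → S v → rank v ≡ d × v ≢ m) → Routing (λ v → S v × x₁ v < a₁)
    routing-around-P m rm m∈P S⊆ = routing-around m rm (S⊆ ∘ proj₁)
      (λ (_ , v∈P) v<m _ → inj₁ (≤-<-trans v<m (x₀<a₀ m) , v∈P))
      (λ {v} _ _ v<m → inj₁ (x₀<a₀ v , ≤-<-trans v<m m∈P))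

    routing-right-P : ∀ {S : Carrier → Set} → suc d < a₀ → (∀ {v} → S v → rank v ≡ d) →
      Routing (λ v → S v × x₁ v < a₁)
    routing-right-P d<a₀ S⊆ = routing-right
      (λ {v} (Sv , v∈P) → inj₁ (≤-<-trans (s≤s (subst (x₀ v ≤_) (sum (S⊆ Sv)) (m≤m+n _ _))) d<a₀ , v∈P))

    part-Q part-P : List Carrier
    part-Q = filter (λ v → a₁ ≤? x₁ v) (level d)
    part-P = filter (λ v → x₁ v <? a₁) (level d)

    ∈-part-Q⁻ : ∀ {v} → v ∈ part-Q → rank v ≡ d × a₁ ≤ x₁ v
    ∈-part-Q⁻ v∈ = let v∈level , v∈Q = ∈-filter⁻ (λ v → a₁ ≤? x₁ v) {xs = level d} v∈ in ∈-level⁻ v∈level , v∈Q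

    ∈-part-P⁻ : ∀ {v} → v ∈ part-P → rank v ≡ d × x₁ v < a₁
    ∈-part-P⁻ v∈ = let v∈level , v∈P = ∈-filter⁻ (λ v → x₁ v <? a₁) {xs = level d} v∈ in ∈-level⁻ v∈level , v∈P

    ∈-part-Q⁺ : ∀ {v} → rank v ≡ d → a₁ ≤ x₁ v → v ∈ part-Q
    ∈-part-Q⁺ rv = ∈-filter⁺ _ (∈-level⁺ rv)

    ∈-part-P⁺ : ∀ {v} → rank v ≡ d → x₁ v < a₁ → v ∈ part-P
    ∈-part-P⁺ rv = ∈-filter⁺ _ (∈-level⁺ rv)

    -- Sending each point of ∇ S to its left neighbour misses the point of Q with x₀ = b₀ - 1.
    ∇-contracts : ∀ {S} q → b₁ ≤ suc d → Subset d S → rank q ≡ d → a₁ ≤ x₁ q →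
      (∀ {v} → v ∈ part-Q → v ∈ S) →
      (∀ {u v w} → u ∈ S → rank w ≡ d → Up u v → Right w v → x₁ v < a₁ → w ∈ S) →
      length (∇ S) < length S
    ∇-contracts {S} q b₁≤ S⊆@(_ , rankS) rq q∈Q Q⊆S leftwards =
      injection⇒length-< (λ v w → Right w v) S (proj₁ ∇S⊆) (Q⊆S (∈-part-Q⁺ rc c∈Q))
        total (λ _ _ (e₀ , e₁) (f₀ , f₁) → coords-injective (trans e₀ (sym f₀)) (trans e₁ (sym f₁)))
      where
      ∇S⊆ : Subset (suc d) (∇ S)
      ∇S⊆ = ∇-Subset S⊆

      extreme : ∃ λ c → rank c ≡ d × suc (x₀ c) ≡ b₀ × a₁ ≤ x₁ c
      extreme = go b₀ refl (x₀<b₀ q q∈Q)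
        where
        go : ∀ b → b ≡ b₀ → x₀ q < b → ∃ λ c → rank c ≡ d × suc (x₀ c) ≡ b₀ × a₁ ≤ x₁ c
        go (suc b) refl (s≤s q₀≤b) = let c , rc , e₀ , e₁ = point-at (inj₂ (≤-refl , d∸b<b₁)) (m+[n∸m]≡n b≤d)
                                     in c , rc , cong suc e₀ , subst (a₁ ≤_) (sym e₁) a₁≤d∸b
          where
          b+a₁≤d : b + a₁ ≤ d
          b+a₁≤d = s≤s⁻¹ corner

          b≤d : b ≤ d
          b≤d = ≤-trans (m≤m+n b a₁) b+a₁≤d

          a₁≤d∸b : a₁ ≤ d ∸ b
          a₁≤d∸b = m+n≤o⇒m≤o∸n a₁ (≤-trans (≤-reflexive (+-comm a₁ b)) b+a₁≤d)

          d∸b<b₁ : d ∸ b < b₁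
          d∸b<b₁ = ≤-<-trans (m≤n+o⇒m∸n≤o d b (≤-trans (≤-reflexive (sym (sum rq))) (+-monoˡ-≤ (x₁ q) q₀≤b))) (x₁<b₁ q)

      c : Carrier
      c = proj₁ extreme
      rc : rank c ≡ d
      rc = proj₁ (proj₂ extreme)
      c∈Q : a₁ ≤ x₁ c
      c∈Q = proj₂ (proj₂ (proj₂ extreme))

      avoids : ∀ {v} → ¬ Right c v
      avoids {v} (e₀ , e₁) = <-irrefl (trans e₀ (proj₁ (proj₂ (proj₂ extreme)))) (x₀<b₀ v (subst (a₁ ≤_) (sym e₁) c∈Q))

      total : ∀ {v} → v ∈ ∇ S → ∃ λ w → w ∈ S × Right w v × w ≢ c
      total {v} v∈∇S with left-neighbour v (proj₂ ∇S⊆ v∈∇S) b₁≤ | ∈-∇⁻ v∈∇S | x₁ v <? a₁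
      ... | w , rw , w→v | u , u∈S , u⋖v | no v∉P =
        w , Q⊆S (∈-part-Q⁺ rw (subst (a₁ ≤_) (proj₂ w→v) (≮⇒≥ v∉P))) , w→v , λ { refl → avoids w→v }
      ... | w , rw , w→v | u , u∈S , u⋖v | yes v∈P with ⋖⇒right⊎up u⋖v
      ...   | inj₁ u→v = u , u∈S , u→v , λ { refl → avoids u→v }
      -- A point of P reached from below needs its left neighbour in `S` too; `leftwards` holds
      -- vacuously when `S` is a single part, and by the order when `S` is a segment.
      ...   | inj₂ u↑v = w , leftwards u∈S rw u↑v w→v v∈P , w→v , λ { refl → avoids w→v }

    -- Translation by (a₀ - b₀ , b₀ - a₀) aligns the right ends of Q and P.
    shift : a₀ ≤ suc d → b₀ + b₁ ≤ a₀ + a₁ → ∀ {v} → rank v ≡ d → a₁ ≤ x₁ v →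
      ∃ λ w → w ∈ part-P × x₀ w + b₀ ≡ x₀ v + a₀ × x₁ w + a₀ ≡ x₁ v + b₀
    shift a₀≤1+d b+b≤a+a {v} rv v∈Q =
      let w , rw , e₀ , e₁ = point-at (inj₁ (i<a₀ , j<a₁)) i+j≡d
      in w , ∈-part-P⁺ rw (subst (_< a₁) (sym e₁) j<a₁) ,
         trans (cong (_+ b₀) e₀) i+b₀ , trans (cong (_+ a₀) e₁) j+a₀
      where
      v₀<b₀ : x₀ v < b₀
      v₀<b₀ = x₀<b₀ v v∈Q
      i j : ℕ
      i = x₀ v + (a₀ ∸ b₀)
      -- The subtraction is exact, as `i < a₀` and `a₀ ≤ suc d`.
      j = d ∸ i

      i+b₀ : i + b₀ ≡ x₀ v + a₀
      i+b₀ = trans (+-assoc (x₀ v) (a₀ ∸ b₀) b₀) (cong (x₀ v +_) (m∸n+n≡m b₀≤a₀))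

      i<a₀ : i < a₀
      i<a₀ = go i (x₀ v) i+b₀ v₀<b₀
        where
        go : ∀ i k → i + b₀ ≡ k + a₀ → k < b₀ → i < a₀
        go i k e k<b₀ = linear 0 (+-mono-≤ k<b₀ (≤-reflexive e)) (solve (i ∷ k ∷ a₀ ∷ b₀ ∷ []))

      i+j≡d : i + j ≡ d
      i+j≡d = m+[n∸m]≡n (s≤s⁻¹ (≤-trans i<a₀ a₀≤1+d))

      j+a₀ : j + a₀ ≡ x₁ v + b₀
      j+a₀ = go i j (x₀ v) (x₁ v) i+b₀ (trans i+j≡d (sym (sum rv)))
        where
        go : ∀ i j k l → i + b₀ ≡ k + a₀ → i + j ≡ k + l → j + a₀ ≡ l + b₀
        go i j k l e f = +-cancelˡ-≡ (k + i) (j + a₀) (l + b₀) (begin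
          k + i + (j + a₀)    ≡⟨ solve (i ∷ j ∷ k ∷ a₀ ∷ []) ⟩
          (i + j) + (k + a₀)  ≡⟨ cong₂ _+_ f (sym e) ⟩
          (k + l) + (i + b₀)  ≡⟨ solve (i ∷ k ∷ l ∷ b₀ ∷ []) ⟩
          k + i + (l + b₀)    ∎)
          where open ≡-Reasoning

      -- The size comparison enters here: `j = x₁ v + b₀ - a₀` is less than `b₀ + b₁ - a₀`, which is
      -- at most `a₁`.
      j<a₁ : j < a₁
      j<a₁ = go j (x₁ v) j+a₀ (x₁<b₁ v)
        where
        go : ∀ j l → j + a₀ ≡ l + b₀ → l < b₁ → j < a₁
        go j l e l<b₁ = linear 0 (+-mono-≤ (+-mono-≤ l<b₁ b+b≤a+a) (≤-reflexive e))
          (solve (j ∷ l ∷ a₀ ∷ a₁ ∷ b₀ ∷ b₁ ∷ []))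

    private
      shift-injective : ∀ {v v′ w} → v ∈ part-Q → v′ ∈ part-Q → x₀ w + b₀ ≡ x₀ v + a₀ → x₀ w + b₀ ≡ x₀ v′ + a₀ → v ≡ v′
      shift-injective v∈ v′∈ e e′ = x₀-determines (proj₁ (∈-part-Q⁻ v∈)) (proj₁ (∈-part-Q⁻ v′∈))
        (+-cancelʳ-≡ a₀ _ _ (trans (sym e) e′))

      part-Q-unique : Unique part-Q
      part-Q-unique = proj₁ (filter-Subset (λ v → a₁ ≤? x₁ v))

    part-Q≤part-P : a₀ ≤ suc d → b₀ + b₁ ≤ a₀ + a₁ → length part-Q ≤ length part-P
    part-Q≤part-P a₀≤ b≤a = injection⇒length-≤ (λ v w → x₀ w + b₀ ≡ x₀ v + a₀) part-P part-Q-unique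
      (λ v∈ → let rv , v∈Q = ∈-part-Q⁻ v∈ ; w , w∈ , e , _ = shift a₀≤ b≤a rv v∈Q in w , w∈ , e)
      shift-injective

    -- The shift lifts Q at most to row `b₀ + b₁ - a₀ - 1`, strictly under the top row `a₁ - 1` of
    -- P, so the point of that row is missed; `suc d < a₀ + a₁` ensures that this point exists.
    part-Q<part-P : a₀ ≤ suc d → suc d < a₀ + a₁ → 0 < a₁ → b₀ + b₁ < a₀ + a₁ → length part-Q < length part-P
    part-Q<part-P a₀≤ d< 0<a₁ b<a = injection⇒length-< (λ v w → x₀ w + b₀ ≡ x₀ v + a₀) part-P part-Q-unique c∈P
      (λ {v} v∈ → let rv , v∈Q = ∈-part-Q⁻ v∈ ; w , w∈ , e , f = shift a₀≤ (<⇒≤ b<a) rv v∈Q in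
        w , w∈ , e , λ w≡c → misses (x₁ w) (x₁ v) f (x₁<b₁ v) (trans (cong (suc ∘ x₁) w≡c) 1+c₁≡a₁))
      shift-injective
      where
      extreme : ∃ λ c → c ∈ part-P × suc (x₁ c) ≡ a₁
      extreme = go a₁ refl 0<a₁
        where
        go : ∀ a → a ≡ a₁ → 0 < a → ∃ λ c → c ∈ part-P × suc (x₁ c) ≡ a₁
        go (suc a) refl _ = let c , rc , _ , e₁ = point-at (inj₁ (d∸a<a₀ , ≤-refl)) (m∸n+n≡m a≤d) in
          c , ∈-part-P⁺ rc (s≤s (≤-reflexive e₁)) , cong suc e₁
          where
          a≤d : a ≤ d
          a≤d = s≤s⁻¹ (≤-trans (m≤n+m (suc a) b₀) corner)

          d∸a<a₀ : d ∸ a < a₀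
          d∸a<a₀ = +-cancelʳ-≤ a (suc (d ∸ a)) a₀ (≤-trans (≤-reflexive (cong suc (m∸n+n≡m a≤d)))
            (s≤s⁻¹ (≤-trans d< (≤-reflexive (+-suc a₀ a)))))

      c : Carrier
      c = proj₁ extreme
      c∈P : c ∈ part-P
      c∈P = proj₁ (proj₂ extreme)
      1+c₁≡a₁ : suc (x₁ c) ≡ a₁
      1+c₁≡a₁ = proj₂ (proj₂ extreme)

      misses : ∀ j l → j + a₀ ≡ l + b₀ → l < b₁ → suc j ≢ a₁
      misses j l e l<b₁ f = 1+n≰n {0} (linear 0
        (+-mono-≤ (+-mono-≤ l<b₁ b<a) (+-mono-≤ (≤-reflexive e) (≤-reflexive (sym f))))
        (solve (j ∷ l ∷ a₀ ∷ a₁ ∷ b₀ ∷ b₁ ∷ [])))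

-- Necessity: no Macaulay order if Q closes first but is the larger part

nonempty : {xs : List A} → 0 < length xs → ∃ λ x → x ∈ xs
nonempty {xs = x ∷ _} _ = x , here refl

module NotMacaulay {R : FiniteRankedPoset} {a₀ a₁ b₀ b₁ : ℕ} (real : Realizes R a₀ a₁ b₀ b₁)
  (b₀<a₀ : b₀ < a₀) (a₁<b₁ : a₁ < b₁) (b₁<a₀ : b₁ < a₀) (a<b : a₀ + a₁ < b₀ + b₁) (0<a₁ : 0 < a₁)
  {_≼_ : Rel (FiniteRankedPoset.Carrier R) 0ℓ} (isDTO : IsDecTotalOrder _≡_ _≼_)
  (macaulay : IsMacaulayOrder R isDTO) where
  open FiniteRankedPoset R
  open Shadow R
  open Segment R isDTO
  open Realizes real
  open Grid real
  open Crossing real (<⇒≤ b₀<a₀) (<⇒≤ a₁<b₁)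

  shadow-Seg-≤ : ∀ {d A} → Subset d A → length (∇ (Seg R isDTO d (length A))) ≤ length (∇ A)
  shadow-Seg-≤ {d} {A} (A! , rankA) = proj₁ (macaulay d A A! (All.tabulate rankA))

  -- Condition (ii) for the segment itself, in the form in which being a segment passes to the next
  -- level.
  shadow-Seg : ∀ {d} q → q ≤ length (level d) → ∃ λ q′ → q′ ≤ length (level (suc d)) ×
               (∇ (Seg R isDTO d q) ∼[ set ] Seg R isDTO (suc d) q′)
  shadow-Seg {d} q q≤ = length (∇ (Seg R isDTO d q)) , Subset⇒length-≤ (∇-Subset (Seg-Subset d q)) ,
    subst (λ n → ∇ (Seg R isDTO d n) ∼[ set ] Seg R isDTO (suc d) (length (∇ (Seg R isDTO d n))))
      (Seg-length d q q≤)
      (let S! , rankS = Seg-Subset d q in proj₂ (macaulay d (Seg R isDTO d q) S! (All.tabulate rankS)))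

  -- At such a level P is smaller than Q and its shadow is smaller still, so the
  -- segment of size ∣P∣ must be P.
  no-segment-in-Q : ∀ {e} q {x} → b₀ + a₁ ≤ suc e → a₀ ≤ suc e → suc e < a₀ + a₁ →
    x ∈ Seg R isDTO e q → (∀ {v} → v ∈ Seg R isDTO e q → a₁ ≤ x₁ v) → ⊥
  no-segment-in-Q {e} q {x} corner a₀≤ e< x∈ inQ = finish
    (search (λ v → (a₁ ≤? x₁ v) ×-dec ¬? (v ∈? S′)) e)
    (search (λ v → (x₁ v <? a₁) ×-dec ¬? (v ∈? S′)) e)
    where
    open TwoParts corner
    -- Reflection exchanges the roles: `T.part-Q` is the part of P, and `T.part-P` that of Q.
    module T = Crossing.TwoParts (transpose real) (<⇒≤ a₁<b₁) (<⇒≤ b₀<a₀)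
                 (≤-trans (≤-reflexive (+-comm a₁ b₀)) corner)

    b₁≤ : b₁ ≤ suc e
    b₁≤ = ≤-trans (<⇒≤ b₁<a₀) a₀≤

    P Q S′ : List Carrier
    P = T.part-Q
    Q = T.part-P
    S′ = Seg R isDTO e (length P)

    P-Subset : Subset e P
    P-Subset = filter-Subset (λ v → b₀ ≤? x₀ v)

    ∣S′∣ : length S′ ≡ length P
    ∣S′∣ = Seg-length e _ (Subset⇒length-≤ P-Subset)

    x₀<b₀⇒a₁≤x₁ : ∀ {i j} → i + j ≡ e → i < b₀ → a₁ ≤ j
    x₀<b₀⇒a₁≤x₁ {i} {j} s i<b₀ = linear 0 (+-mono-≤ (+-mono-≤ i<b₀ corner) (≤-reflexive (sym s)))
      (solve (i ∷ j ∷ e ∷ a₁ ∷ b₀ ∷ []))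

    x₁<a₁⇒b₀≤x₀ : ∀ {i j} → i + j ≡ e → j < a₁ → b₀ ≤ i
    x₁<a₁⇒b₀≤x₀ {i} {j} s j<a₁ = linear 0 (+-mono-≤ (+-mono-≤ j<a₁ corner) (≤-reflexive (sym s)))
      (solve (i ∷ j ∷ e ∷ a₁ ∷ b₀ ∷ []))

    p : ∃ λ v → v ∈ P
    p = go a₁ refl 0<a₁
      where
      go : ∀ a → a ≡ a₁ → 0 < a → ∃ λ v → v ∈ P
      go (suc a) refl _ =
        let v , rv , e₀ , e₁ = point-at (inj₁ (e∸a<a₀ , ≤-refl)) (m∸n+n≡m a≤e)
        in v , T.∈-part-Q⁺ rv (x₁<a₁⇒b₀≤x₀ (sum rv) (s≤s (≤-reflexive e₁)))
        where
        a≤e : a ≤ e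
        a≤e = s≤s⁻¹ (≤-trans (m≤n+m (suc a) b₀) corner)

        e∸a<a₀ : e ∸ a < a₀
        e∸a<a₀ = +-cancelʳ-≤ a (suc (e ∸ a)) a₀ (≤-trans (≤-reflexive (cong suc (m∸n+n≡m a≤e)))
          (s≤s⁻¹ (≤-trans e< (≤-reflexive (+-suc a₀ a)))))

    ∣∇S′∣<∣P∣ : length (∇ S′) < length P
    ∣∇S′∣<∣P∣ = ≤-<-trans (shadow-Seg-≤ P-Subset)
      (let rp , p∈ = T.∈-part-Q⁻ (proj₂ p) in
       T.∇-contracts (proj₁ p) a₀≤ P-Subset rp p∈ id
         (λ { u∈P _ (_ , e₁) _ v₁<b₀ → contradiction (≤-trans (proj₂ (T.∈-part-Q⁻ u∈P)) (≤-trans (n≤1+n _) (≤-reflexive (sym e₁)))) (<⇒≱ v₁<b₀) }))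

    ∣P∣<∣Q∣ : length P < length Q
    ∣P∣<∣Q∣ = T.part-Q<part-P b₁≤ (<-trans e< (<-≤-trans a<b (≤-reflexive (+-comm b₀ b₁)))) 0<b₀
      (≤-<-trans (≤-reflexive (+-comm a₁ a₀)) (<-≤-trans a<b (≤-reflexive (+-comm b₀ b₁))))
      where
      0<b₀ : 0 < b₀
      0<b₀ = ≤-<-trans z≤n (x₀<b₀ x (inQ x∈))

    -- The larger of `x` and `y` lies in both segments, and the first segment is inside Q.
    Q∩S′ : ∃ λ y → y ∈ S′ × a₁ ≤ x₁ y
    Q∩S′ with nonempty (≤-trans (≤-<-trans z≤n ∣∇S′∣<∣P∣) (≤-reflexive (sym ∣S′∣)))
    ... | y , y∈S′ with IsDecTotalOrder.total isDTO x y
    ...   | inj₁ x≼y = y , y∈S′ , inQ (Seg-upClosed e q x∈ (proj₂ (Seg-Subset e _) y∈S′) x≼y)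
    ...   | inj₂ y≼x = x , Seg-upClosed e _ y∈S′ (proj₂ (Seg-Subset e q) x∈) y≼x , inQ x∈

    -- `S′` has the size of P: too small to contain Q, and, having a point in Q, unable to contain
    -- P. Missing a point of each part it can be routed, so its shadow is not smaller, a
    -- contradiction.
    finish : (∃ λ v → rank v ≡ e × a₁ ≤ x₁ v × v ∉ S′) ⊎ (∀ v → rank v ≡ e → ¬ (a₁ ≤ x₁ v × v ∉ S′)) →
             (∃ λ v → rank v ≡ e × x₁ v < a₁ × v ∉ S′) ⊎ (∀ v → rank v ≡ e → ¬ (x₁ v < a₁ × v ∉ S′)) → ⊥
    finish (inj₂ Q⊆) _ = <-irrefl refl (<-≤-trans ∣P∣<∣Q∣
      (≤-trans (⊆⇒length-≤ (proj₁ (filter-Subset (λ v → x₀ v <? b₀))) Q⊆S′) (≤-reflexive ∣S′∣)))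
      where
      Q⊆S′ : ∀ {v} → v ∈ Q → v ∈ S′
      Q⊆S′ {v} v∈Q with v ∈? S′ | T.∈-part-P⁻ v∈Q
      ... | yes v∈S′ | _          = v∈S′
      ... | no  v∉S′ | rv , v₀<b₀ = contradiction (x₀<b₀⇒a₁≤x₁ (sum rv) v₀<b₀ , v∉S′) (Q⊆ v rv)
    finish _ (inj₂ P⊆) = <-irrefl (sym ∣S′∣)
      (⊂⇒length-< (proj₁ P-Subset) P⊆S′ (proj₁ (proj₂ Q∩S′))
        λ y∈P → contradiction (x₀<b₀ (proj₁ Q∩S′) (proj₂ (proj₂ Q∩S′))) (≤⇒≯ (proj₂ (T.∈-part-Q⁻ y∈P))))
      where
      P⊆S′ : ∀ {v} → v ∈ P → v ∈ S′
      P⊆S′ {v} v∈P with v ∈? S′ | T.∈-part-Q⁻ v∈P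
      ... | yes v∈S′ | _          = v∈S′
      ... | no  v∉S′ | rv , b₀≤v₀ = contradiction
        (≰⇒> (λ a₁≤v₁ → <⇒≱ (x₀<b₀ v a₁≤v₁) b₀≤v₀) , v∉S′) (P⊆ v rv)
    finish (inj₁ (mQ , rQ , mQ∈Q , mQ∉S′)) (inj₁ (mP , rP , mP∈P , mP∉S′)) = <-irrefl refl
      (<-≤-trans ∣∇S′∣<∣P∣ (≤-trans (≤-reflexive (sym ∣S′∣))
        (routing⇒length-≤ (proj₁ (Seg-Subset e _)) (combine (proj₂ (Seg-Subset e _))
          (routing-around-Q mQ rQ mQ∈Q λ v∈ → proj₂ (Seg-Subset e _) v∈ , λ { refl → mQ∉S′ v∈ })
          (routing-around-P mP rP mP∈P λ v∈ → proj₂ (Seg-Subset e _) v∈ , λ { refl → mP∉S′ v∈ })))))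

  -- Below the corner rank Q is not yet a separate part, and its top row stands in for it. No move
  -- up leaves that row, so shadows stay inside it.
  TopSegment : ℕ → Set
  TopSegment e = ∃ λ q → q ≤ length (level e) × (∃ λ x → x ∈ Seg R isDTO e q) ×
                 (∀ {v} → v ∈ Seg R isDTO e q → suc (x₁ v) ≡ b₁)

  no-up-from-top : ∀ {u v} → suc (x₁ u) ≡ b₁ → ¬ Up u v
  no-up-from-top {u} {v} top (_ , e₁) = <-irrefl (trans e₁ top) (x₁<b₁ v)

  TopSegment-suc : ∀ {e} → suc e < b₀ + a₁ → TopSegment e → TopSegment (suc e)
  TopSegment-suc {e} e< (q , q≤ , (x , x∈) , top) =
    let q′ , q′≤ , eq = shadow-Seg q q≤
        y , e₀ , e₁ = point (inj₂ (right-x (x₀ x) (x₁ x) (sum (proj₂ (Seg-Subset e q) x∈)) (top x∈) , x₁<b₁ x))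
    in q′ , q′≤ , (y , Equivalence.to eq (∈-∇⁺ x∈ (right⇒⋖ (e₀ , e₁)))) ,
       λ v∈ → let u , u∈ , u⋖v = ∈-∇⁻ (Equivalence.from eq v∈) in
         [ (λ (_ , f₁) → trans (cong suc f₁) (top u∈))
         , (λ u↑v → contradiction u↑v (no-up-from-top (top u∈))) ]′ (⋖⇒right⊎up u⋖v)
    where
    right-x : ∀ i j → i + j ≡ e → suc j ≡ b₁ → suc i < b₀
    right-x i j s t = linear 0 (+-mono-≤ (+-mono-≤ e< a₁<b₁) (+-mono-≤ (≤-reflexive s) (≤-reflexive (sym t))))
      (solve (i ∷ j ∷ e ∷ a₁ ∷ b₀ ∷ b₁ ∷ []))

  TopSegment-climb : ∀ k {e E} → e + k ≡ E → E < b₀ + a₁ → TopSegment e → TopSegment E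
  TopSegment-climb zero    {e} refl E< t = subst TopSegment (sym (+-identityʳ e)) t
  TopSegment-climb (suc k) {e} refl E< t = TopSegment-climb k (sym (+-suc e k)) E<
    (TopSegment-suc (≤-<-trans (≤-trans (s≤s (m≤m+n e k)) (≤-reflexive (sym (+-suc e k)))) E<) t)

  -- Rank `a₀ - 2`: the outer wall of Q is present, that of P appears one rank later. Some segment
  -- is forced to consist of points of Q, which `no-segment-in-Q` refutes in a higher rank.
  module _ {d : ℕ} (a₀≡ : a₀ ≡ suc (suc d)) where

    top-left : ∃ λ v → rank v ≡ d × suc (x₁ v) ≡ b₁ × suc (x₀ v) < b₀
    top-left = go b₁ refl (≤-<-trans z≤n a₁<b₁)
      where
      go : ∀ b → b ≡ b₁ → 0 < b → ∃ λ v → rank v ≡ d × suc (x₁ v) ≡ b₁ × suc (x₀ v) < b₀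
      go (suc b) refl _ = let v , rv , e₀ , e₁ = point-at (inj₂ (<-trans (n<1+n _) narrow , ≤-refl)) (m∸n+n≡m b≤d)
                          in v , rv , cong suc e₁ , subst (λ i → suc i < b₀) (sym e₀) narrow
        where
        b≤d : b ≤ d
        b≤d = s≤s⁻¹ (s≤s⁻¹ (≤-trans b₁<a₀ (≤-reflexive a₀≡)))

        narrow : suc (d ∸ b) < b₀
        narrow = go′ (d ∸ b) (m∸n+n≡m b≤d)
          where
          go′ : ∀ i → i + b ≡ d → suc i < b₀
          -- `suc i` equals `a₀ - b₁`, which `a<b` puts below `b₀ - a₁`; hence the slack `a₁`.
          go′ i s = linear a₁ (+-mono-≤ a<b (+-mono-≤ (≤-reflexive s) (≤-reflexive (sym a₀≡))))
            (solve (i ∷ b ∷ d ∷ a₀ ∷ a₁ ∷ b₀ ∷ []))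

    ℓ : Carrier
    ℓ = proj₁ top-left
    rℓ : rank ℓ ≡ d
    rℓ = proj₁ (proj₂ top-left)
    ℓ-top : suc (x₁ ℓ) ≡ b₁
    ℓ-top = proj₁ (proj₂ (proj₂ top-left))

    b₁≤1+d : b₁ ≤ suc d
    b₁≤1+d = s≤s⁻¹ (≤-trans b₁<a₀ (≤-reflexive a₀≡))

    -- Q shrinks in the shadow, while P is still open and can always be routed. A segment of the
    -- size of Q must shrink as well, hence contains Q and equals it; its shadow is a segment inside
    -- Q in rank `a₀ - 1`.
    two-parts-already : b₀ + a₁ ≤ suc d → ⊥
    two-parts-already corner =
      let q′ , _ , eq = shadow-Seg n (Subset⇒length-≤ Q-Subset)
          y , e₀ , e₁ = point (inj₂ (proj₂ (proj₂ (proj₂ top-left)) , x₁<b₁ ℓ))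
      in no-segment-in-Q q′ (≤-trans corner (n≤1+n _)) (≤-reflexive a₀≡)
           (≤-<-trans (≤-reflexive (sym a₀≡)) (≤-trans (≤-reflexive (+-comm 1 a₀)) (+-monoʳ-≤ a₀ 0<a₁)))
           (Equivalence.to eq (∈-∇⁺ (Q⊆S (∈-part-Q⁺ rℓ ℓ∈Q)) (right⇒⋖ (e₀ , e₁))))
           (λ v∈ → let u , u∈ , u⋖v = ∈-∇⁻ (Equivalence.from eq v∈) in
             ≤-trans (S⊆Q u∈) (proj₂ (⊑⁻ (proj₁ (proj₁ u⋖v)))))
      where
      open TwoParts corner
      n : ℕ
      n = length part-Q
      S : List Carrier
      S = Seg R isDTO d n

      Q-Subset : Subset d part-Q
      Q-Subset = filter-Subset (λ v → a₁ ≤? x₁ v)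

      ℓ∈Q : a₁ ≤ x₁ ℓ
      ℓ∈Q = s≤s⁻¹ (≤-trans a₁<b₁ (≤-reflexive (sym ℓ-top)))

      ∣S∣ : length S ≡ n
      ∣S∣ = Seg-length d n (Subset⇒length-≤ Q-Subset)

      ∣∇S∣<n : length (∇ S) < n
      ∣∇S∣<n = ≤-<-trans (shadow-Seg-≤ Q-Subset) (∇-contracts ℓ b₁≤1+d Q-Subset rℓ ℓ∈Q id
        (λ u∈Q _ (_ , e₁) _ v₁<a₁ → contradiction
          (≤-trans (proj₂ (∈-part-Q⁻ u∈Q)) (≤-trans (n≤1+n _) (≤-reflexive (sym e₁)))) (<⇒≱ v₁<a₁)))

      Q⊆S : ∀ {v} → v ∈ part-Q → v ∈ S
      Q⊆S {m} m∈Q with m ∈? S | ∈-part-Q⁻ m∈Q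
      ... | yes m∈S | _         = m∈S
      ... | no  m∉S | rm , a₁≤m = contradiction
        (≤-trans (≤-reflexive (sym ∣S∣)) (routing⇒length-≤ (proj₁ (Seg-Subset d n)) (combine (proj₂ (Seg-Subset d n))
          (routing-around-Q m rm a₁≤m λ v∈ → proj₂ (Seg-Subset d n) v∈ , λ { refl → m∉S v∈ })
          (routing-right-P (≤-reflexive (sym a₀≡)) (proj₂ (Seg-Subset d n))))))
        (<⇒≱ ∣∇S∣<n)

      S⊆Q : ∀ {v} → v ∈ S → a₁ ≤ x₁ v
      S⊆Q {v} v∈S with a₁ ≤? x₁ v
      ... | yes v∈Q = v∈Q
      ... | no  v∉Q = contradiction (sym ∣S∣) (<⇒≢
        (⊂⇒length-< (proj₁ Q-Subset) Q⊆S v∈S (v∉Q ∘ proj₂ ∘ ∈-part-Q⁻)))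

    -- `ℓ` has a single upper neighbour, whereas in this rank every point off the top row has two.
    -- So the largest point lies in the top row.
    TopSegment-start : suc d < b₀ + a₁ → TopSegment d
    TopSegment-start below = 1 , 1≤ , nonempty (≤-reflexive (sym (Seg-length d 1 1≤))) , top
      where
      ℓ-Subset : Subset d (ℓ ∷ [])
      ℓ-Subset = (All.[] ∷ []) , λ { (here refl) → rℓ }

      1≤ : 1 ≤ length (level d)
      1≤ = Subset⇒length-≤ ℓ-Subset

      ∣∇ℓ∣≤1 : length (∇ (ℓ ∷ [])) ≤ 1
      ∣∇ℓ∣≤1 = injection⇒length-≤ (λ v _ → Right ℓ v) (ℓ ∷ []) (proj₁ (∇-Subset ℓ-Subset))
        (λ v∈ → ℓ , here refl , right-of-ℓ (∈-∇⁻ v∈))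
        (λ _ _ (e₀ , e₁) (f₀ , f₁) → coords-injective (trans e₀ (sym f₀)) (trans e₁ (sym f₁)))
        where
        right-of-ℓ : ∀ {v} → (∃ λ u → u ∈ ℓ ∷ [] × u ⋖ v) → Right ℓ v
        right-of-ℓ (_ , here refl , ℓ⋖v) = [ id , (λ ℓ↑v → contradiction ℓ↑v (no-up-from-top ℓ-top)) ]′ (⋖⇒right⊎up ℓ⋖v)

      top : ∀ {v} → v ∈ Seg R isDTO d 1 → suc (x₁ v) ≡ b₁
      top {v} v∈ with m≤n⇒m<n∨m≡n (x₁<b₁ v)
      ... | inj₂ v-top = v-top
      ... | inj₁ 1+v₁<b₁ =
        let rv = proj₂ (Seg-Subset d 1) v∈
            v₀≤d = subst (x₀ v ≤_) (sum rv) (m≤m+n (x₀ v) (x₁ v))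
            1+v₀<a₀ = ≤-trans (s≤s (s≤s v₀≤d)) (≤-reflexive (sym a₀≡))
            w , e₀ , e₁ = point (inM-below-corner 1+v₀<a₀ (x₁<b₁ v) (subst (_< b₀ + a₁) (cong suc (sym (sum rv))) below))
            z , f₀ , f₁ = point (inM-below-corner (x₀<a₀ v) 1+v₁<b₁
              (subst (_< b₀ + a₁) (trans (cong suc (sym (sum rv))) (sym (+-suc (x₀ v) (x₁ v)))) below))
        in contradiction
          (≤-trans (⊆⇒length-≤ {xs = w ∷ z ∷ []}
              (((λ w≡z → 1+n≢n (trans (sym e₀) (trans (cong x₀ w≡z) f₀))) All.∷ All.[]) ∷ All.[] ∷ [])
              λ { (here refl) → ∈-∇⁺ v∈ (right⇒⋖ (e₀ , e₁)) ; (there (here refl)) → ∈-∇⁺ v∈ (up⇒⋖ (f₀ , f₁)) })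
            (≤-trans (shadow-Seg-≤ ℓ-Subset) ∣∇ℓ∣≤1))
          1+n≰n

    -- `D` is the first rank with two parts. Climbing along the top row reaches it, and the row lies
    -- in Q since `a₁ < b₁`.
    single-part : ∀ D → suc D ≡ b₀ + a₁ → suc d < b₀ + a₁ → ⊥
    single-part D 1+D≡ below =
      let q , _ , (x , x∈) , top = TopSegment-climb (D ∸ d) (m+[n∸m]≡n (<⇒≤ d<D)) (≤-reflexive 1+D≡) (TopSegment-start below)
      in no-segment-in-Q q (≤-reflexive (sym 1+D≡)) (≤-trans (≤-reflexive a₀≡) (s≤s d<D))
           (subst (_< a₀ + a₁) (sym 1+D≡) (+-monoˡ-< a₁ b₀<a₀)) x∈
           (λ v∈ → s≤s⁻¹ (≤-trans a₁<b₁ (≤-reflexive (sym (top v∈)))))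
      where
      d<D : d < D
      d<D = s≤s⁻¹ (subst (suc d <_) (sym 1+D≡) below)

    impossible-at : ⊥
    impossible-at with b₀ + a₁ ≤? suc d
    ... | yes corner = two-parts-already corner
    ... | no  below  = go (b₀ + a₁) refl (≰⇒> below)
      where
      go : ∀ s → s ≡ b₀ + a₁ → suc d < s → ⊥
      go (suc D) e below′ = single-part D e (subst (suc d <_) e below′)

  impossible : ⊥
  impossible = go a₀ refl (<-≤-trans (s≤s (≤-trans 0<a₁ (<⇒≤ a₁<b₁))) b₁<a₀)
    where
    go : ∀ a → a ≡ a₀ → 1 < a → ⊥
    go (suc (suc d)) e _ = impossible-at (sym e)
    go (suc zero)    _ (s≤s ())

-- Sufficiency: an order that fills Q first, for Q closing no later than P and not larger in the end

module IsMacaulay {R : FiniteRankedPoset} {a₀ a₁ b₀ b₁ : ℕ} (real : Realizes R a₀ a₁ b₀ b₁)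
  (b₀≤a₀ : b₀ ≤ a₀) (a₁≤b₁ : a₁ ≤ b₁) (b₁≤a₀ : b₁ ≤ a₀) (b≤a : b₀ + b₁ ≤ a₀ + a₁) where
  open FiniteRankedPoset R
  open Shadow R
  open Realizes real
  open Grid real
  open Crossing real b₀≤a₀ a₁≤b₁

  -- No wall is in reach: points before `m` go up, `m` and the points after it go right, and the
  -- point above `m` is left over.
  length-<-∇ : ∀ {d A m} → suc d < b₁ → suc d < b₀ + a₁ → Subset d A → m ∈ A → length A < length (∇ A)
  length-<-∇ {d} {A} {m} d<b₁ d<corner (A! , rankA) m∈A =
    injection⇒length-< _~_ (∇ A) A! (∈-∇⁺ m∈A (up⇒⋖ (e₀ , e₁))) total injective
    where
    inM : ∀ {k l} → k + l ≡ suc d → InM k l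
    inM {k} {l} e = inM-below-corner
      (≤-<-trans (≤-trans (m≤m+n k l) (≤-reflexive e)) (<-≤-trans d<b₁ b₁≤a₀))
      (≤-<-trans (≤-trans (m≤n+m l k) (≤-reflexive e)) d<b₁)
      (≤-<-trans (≤-reflexive e) d<corner)

    up : ∀ {v} → v ∈ A → ∃ (Up v)
    up {v} v∈A = point (inM (trans (+-suc (x₀ v) (x₁ v)) (cong suc (sum (rankA v∈A)))))

    right : ∀ {v} → v ∈ A → ∃ (Right v)
    right v∈A = point (inM (cong suc (sum (rankA v∈A))))

    above : ∃ (Up m)
    above = up m∈A
    y : Carrier
    y = proj₁ above
    e₀ : x₀ y ≡ x₀ m
    e₀ = proj₁ (proj₂ above)
    e₁ : x₁ y ≡ suc (x₁ m)
    e₁ = proj₂ (proj₂ above)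

    _~_ : Carrier → Carrier → Set
    v ~ w = (x₀ v < x₀ m × Up v w) ⊎ (x₀ m ≤ x₀ v × Right v w)

    total : ∀ {v} → v ∈ A → ∃ λ w → w ∈ ∇ A × v ~ w × w ≢ y
    total {v} v∈A with x₀ v <? x₀ m
    ... | yes v<m = let w , f₀ , f₁ = up v∈A in w , ∈-∇⁺ v∈A (up⇒⋖ (f₀ , f₁)) , inj₁ (v<m , f₀ , f₁) ,
      λ w≡y → <-irrefl (trans (sym f₀) (trans (cong x₀ w≡y) e₀)) v<m
    ... | no  v≮m = let w , f₀ , f₁ = right v∈A in w , ∈-∇⁺ v∈A (right⇒⋖ (f₀ , f₁)) , inj₂ (≮⇒≥ v≮m , f₀ , f₁) ,
      λ w≡y → <-irrefl (trans (sym e₀) (trans (sym (cong x₀ w≡y)) f₀)) (s≤s (≮⇒≥ v≮m))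

    mixed : ∀ {v v′ w} → x₀ v < x₀ m → Up v w → x₀ m ≤ x₀ v′ → Right v′ w → v ≡ v′
    mixed v<m (f₀ , _) m≤v′ (g₀ , _) =
      contradiction (≤-trans m≤v′ (≤-trans (n≤1+n _) (≤-reflexive (trans (sym g₀) f₀)))) (<⇒≱ v<m)

    injective : ∀ {v v′ w} → v ∈ A → v′ ∈ A → v ~ w → v′ ~ w → v ≡ v′
    injective _ _ (inj₁ (_ , f₀ , f₁)) (inj₁ (_ , g₀ , g₁)) =
      coords-injective (trans (sym f₀) g₀) (suc-injective (trans (sym f₁) g₁))
    injective _ _ (inj₂ (_ , f₀ , f₁)) (inj₂ (_ , g₀ , g₁)) =
      coords-injective (suc-injective (trans (sym f₀) g₀)) (trans (sym f₁) g₁)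
    injective _ _ (inj₁ (v<m , f)) (inj₂ (m≤v′ , g)) = mixed v<m f m≤v′ g
    injective _ _ (inj₂ (m≤v , f)) (inj₁ (v′<m , g)) = sym (mixed v′<m g m≤v f)

  module Order (T : ℕ) where

    height : Carrier → ℕ
    height v = x₁ v ⊓ T

    -- On one level `height` and `x₀` already decide; `x₁` makes the relation antisymmetric across
    -- levels.
    key : Carrier → ℕ × ℕ × ℕ
    key v = height v , x₀ v , x₁ v

    private
      _≤ₗₑₓ_ : Rel (ℕ × ℕ × ℕ) 0ℓ
      _≤ₗₑₓ_ = ×-Lex _≡_ _≤_ (×-Lex _≡_ _≤_ _≤_)

      lex : IsDecTotalOrder (Pointwise _≡_ (Pointwise _≡_ _≡_)) _≤ₗₑₓ_
      lex = ×-isDecTotalOrder ≤-isDecTotalOrder (×-isDecTotalOrder ≤-isDecTotalOrder ≤-isDecTotalOrder)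

      module Lex = IsDecTotalOrder lex

    -- Within a level: heights T, T + 1, … come first in this order, then T - 1, T - 2, …, 0.
    infix 4 _≼_
    _≼_ : Rel Carrier 0ℓ
    v ≼ w = key v ≤ₗₑₓ key w

    isDTO : IsDecTotalOrder _≡_ _≼_
    isDTO = record
      { isTotalOrder = record
        { isPartialOrder = record
          { isPreorder = record
            { isEquivalence = isEquivalence
            ; reflexive     = λ { {v} refl → Lex.refl {key v} }
            ; trans         = λ {u} {v} {w} → Lex.trans {key u} {key v} {key w}
            }
          ; antisym = λ {v} {w} p q → let _ , e₀ , e₁ = Lex.antisym {key v} {key w} p q in coords-injective e₀ e₁
          }
        ; total = λ v w → Lex.total (key v) (key w)
        }
      ; _≟_  = _≟_
      ; _≤?_ = λ v w → key v Lex.≤? key w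
      }

    open Segment R isDTO public

    ≼-intro : ∀ {d v w} → rank v ≡ d → rank w ≡ d → height v ≤ height w →
              (height v ≡ height w → x₀ v ≤ x₀ w) → v ≼ w
    ≼-intro {v = v} rv rw h≤h x≤x with m≤n⇒m<n∨m≡n h≤h
    ... | inj₁ h<h = inj₁ (<⇒≤ h<h , <⇒≢ h<h)
    ... | inj₂ h≡h with m≤n⇒m<n∨m≡n (x≤x h≡h)
    ...   | inj₁ x<x = inj₂ (h≡h , inj₁ (<⇒≤ x<x , <⇒≢ x<x))
    ...   | inj₂ x≡x = inj₂ (h≡h , inj₂ (x≡x , ≤-reflexive (cong x₁ (x₀-determines rv rw x≡x))))

    ≼⇒height-≤ : ∀ {v w} → v ≼ w → height v ≤ height w
    ≼⇒height-≤ (inj₁ (h≤h , _)) = h≤h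
    ≼⇒height-≤ (inj₂ (h≡h , _)) = ≤-reflexive h≡h

    ≼⇒x₀-≤ : ∀ {v w} → v ≼ w → height v ≡ height w → x₀ v ≤ x₀ w
    ≼⇒x₀-≤ (inj₁ (_ , h≢h))              h≡h = contradiction h≡h h≢h
    ≼⇒x₀-≤ (inj₂ (_ , inj₁ (x≤x , _)))   _   = x≤x
    ≼⇒x₀-≤ (inj₂ (_ , inj₂ (x≡x , _)))   _   = ≤-reflexive x≡x

    height-≡T : ∀ {v} → T ≤ x₁ v → height v ≡ T
    height-≡T = m≥n⇒m⊓n≡n

    height-≡x₁ : ∀ {v} → x₁ v ≤ T → height v ≡ x₁ v
    height-≡x₁ = m≤n⇒m⊓n≡m

    height<T⇒≡x₁ : ∀ {v} → height v < T → height v ≡ x₁ v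
    height<T⇒≡x₁ {v} h<T with ⊓-sel (x₁ v) T
    ... | inj₁ e = e
    ... | inj₂ e = contradiction h<T (<-irrefl e)

    -- If `z` lies in a lower row than `y`, both have height `T`, and the left neighbour of `z` is
    -- at least `u` in the order. If it lies in a higher row, `y` is under row `T`, and the point
    -- below `z` is at least `u`.
    ∇-upClosed : ∀ {d S} → Subset d S → UpClosed d S → UpClosed (suc d) (∇ S)
    ∇-upClosed {d} {S} S⊆ upS {y} {z} y∈ rz y≼z with ∈-∇⁻ y∈ | proj₂ (∇-Subset S⊆) y∈ | <-cmp (x₁ z) (x₁ y)
    ... | _ | ry | tri≈ _ z₁≡y₁ _ = subst (_∈ ∇ S) (x₁-determines ry rz (sym z₁≡y₁)) y∈
    ... | u , u∈S , u⋖y | ry | tri< z₁<y₁ _ _ =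
      let w , rw , w₀ , w₁ = left rz (≤-<-trans z≤n y₀<z₀) in
      ∈-∇⁺ (upS u∈S rw (≼-intro (proj₂ S⊆ u∈S) rw
        (≤-trans (m⊓n≤n (x₁ u) T) (≤-reflexive (sym (height-≡T {w} (subst (T ≤_) w₁ T≤z₁)))))
        (λ _ → ≤-trans (proj₁ (⊑⁻ (proj₁ (proj₁ u⋖y)))) (s≤s⁻¹ (subst (x₀ y <_) w₀ y₀<z₀)))))
        (right⇒⋖ (w₀ , w₁))
      where
      y₀<z₀ : x₀ y < x₀ z
      y₀<z₀ = equal-sums-< {x₁ z} {x₀ z} {x₁ y} {x₀ y}
        (trans (+-comm (x₁ z) (x₀ z)) (trans (same-rank rz ry) (+-comm (x₀ y) (x₁ y)))) z₁<y₁

      T≤z₁ : T ≤ x₁ z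
      T≤z₁ with T ≤? x₁ z
      ... | yes T≤ = T≤
      ... | no  T≰ = contradiction (≼⇒height-≤ {y} {z} y≼z)
        (<⇒≱ (≤-<-trans (m⊓n≤m (x₁ z) T) (⊓-pres-m< z₁<y₁ (≰⇒> T≰))))
    ... | u , u∈S , u⋖y | ry | tri> _ _ y₁<z₁ =
      let w , rw , w₀ , w₁ = below rz (≤-<-trans z≤n y₁<z₁)
          u₁≤w₁ = ≤-trans u₁≤y₁ (s≤s⁻¹ (subst (x₁ y <_) w₁ y₁<z₁))
      in ∈-∇⁺ (upS u∈S rw (≼-intro (proj₂ S⊆ u∈S) rw
           (≤-trans (≤-reflexive u-height) (⊓-glb u₁≤w₁ (<⇒≤ u₁<T)))
           (λ h≡h → ≤-reflexive (cong x₀ (x₁-determines (proj₂ S⊆ u∈S) rw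
             (trans (sym u-height) (trans h≡h
               (height<T⇒≡x₁ {w} (subst (_< T) (trans (sym u-height) h≡h) u₁<T)))))))))
         (up⇒⋖ (w₀ , w₁))
      where
      y₁<T : x₁ y < T
      y₁<T with x₁ y <? T
      ... | yes y₁<T = y₁<T
      ... | no  y₁≮T = contradiction
        (≼⇒x₀-≤ {y} {z} y≼z (trans (height-≡T {y} (≮⇒≥ y₁≮T)) (sym (height-≡T {z} (≤-trans (≮⇒≥ y₁≮T) (<⇒≤ y₁<z₁))))))
        (<⇒≱ (equal-sums-< {x₁ y} {x₀ y} {x₁ z} {x₀ z}
          (trans (+-comm (x₁ y) (x₀ y)) (trans (same-rank ry rz) (+-comm (x₀ z) (x₁ z)))) y₁<z₁))

      u₁≤y₁ : x₁ u ≤ x₁ y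
      u₁≤y₁ = proj₂ (⊑⁻ (proj₁ (proj₁ u⋖y)))
      u₁<T : x₁ u < T
      u₁<T = ≤-<-trans u₁≤y₁ y₁<T
      u-height : height u ≡ x₁ u
      u-height = height-≡x₁ {u} (<⇒≤ u₁<T)

    -- Every level has at most one special point; away from it, ↘ maps ∇ S injectively into
    -- S for any segment S.
    Special : Carrier → Set
    Special v = x₁ v ≡ T ⊎ (x₀ v ≡ 0 × x₁ v < T)

    Special-unique : ∀ {d v w} → rank v ≡ d → rank w ≡ d → Special v → Special w → v ≡ w
    Special-unique rv rw (inj₁ e)       (inj₁ f)       = x₁-determines rv rw (trans e (sym f))
    Special-unique rv rw (inj₂ (e , _)) (inj₂ (f , _)) = x₀-determines rv rw (trans e (sym f))
    Special-unique rv rw (inj₁ e) (inj₂ (f , w<T)) = contradiction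
      (≤-trans (≤-reflexive (sym e)) (≤-trans (m≤n+m _ _) (≤-reflexive (trans (same-rank rv rw) (cong (_+ _) f)))))
      (<⇒≱ w<T)
    Special-unique rv rw (inj₂ (e , v<T)) (inj₁ f) = contradiction
      (≤-trans (≤-reflexive (sym f)) (≤-trans (m≤n+m _ _) (≤-reflexive (trans (same-rank rw rv) (cong (_+ _) e)))))
      (<⇒≱ v<T)

    _↘_ : Carrier → Carrier → Set
    v ↘ w = (x₁ v < T × Right w v) ⊎ (T < x₁ v × Up w v)

    ↘-injective : ∀ {v v′ w} → v ↘ w → v′ ↘ w → v ≡ v′
    ↘-injective (inj₁ (_ , e₀ , e₁)) (inj₁ (_ , f₀ , f₁)) = coords-injective (trans e₀ (sym f₀)) (trans e₁ (sym f₁))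
    ↘-injective (inj₂ (_ , e₀ , e₁)) (inj₂ (_ , f₀ , f₁)) = coords-injective (trans e₀ (sym f₀)) (trans e₁ (sym f₁))
    ↘-injective (inj₁ (v<T , _ , e₁)) (inj₂ (T<v′ , _ , f₁)) =
      contradiction (subst (T <_) (trans f₁ (cong suc (sym e₁))) T<v′) (<⇒≱ (s≤s v<T))
    ↘-injective (inj₂ (T<v , _ , e₁)) (inj₁ (v′<T , _ , f₁)) =
      contradiction (subst (T <_) (trans e₁ (cong suc (sym f₁))) T<v) (<⇒≱ (s≤s v′<T))

    -- If `v` is reached from its other lower neighbour `u`, the one chosen by `↘` is larger than
    -- `u`, so it is in `S` too; it is absent only for `x₀ v ≡ 0`. Row `T` is set apart because
    -- either neighbour there may already be the image of an adjacent point.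
    ∇⇒↘ : ∀ {d S v} → Subset d S → UpClosed d S → v ∈ ∇ S → Special v ⊎ (∃ λ w → w ∈ S × v ↘ w)
    ∇⇒↘ {d} {S} {v} S⊆ upS v∈ with ∈-∇⁻ v∈ | proj₂ (∇-Subset S⊆) v∈ | <-cmp (x₁ v) T
    ... | _ | _ | tri≈ _ v₁≡T _ = inj₁ (inj₁ v₁≡T)
    ... | u , u∈S , u⋖v | rv | tri< v₁<T _ _ with ⋖⇒right⊎up u⋖v
    ...   | inj₁ u→v = inj₂ (u , u∈S , inj₁ (v₁<T , u→v))
    ...   | inj₂ (e₀ , e₁) with x₀ v ℕ.≟ 0
    ...     | yes v₀≡0 = inj₁ (inj₂ (v₀≡0 , v₁<T))
    ...     | no  v₀≢0 =
      let w , rw , w₀ , w₁ = left rv (n≢0⇒n>0 v₀≢0)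
          u<w : height u < height w
          u<w = ≤-<-trans (m⊓n≤m (x₁ u) T) (⊓-pres-m< (subst (x₁ u <_) w₁ (≤-reflexive (sym e₁)))
                  (<-trans (≤-reflexive (sym e₁)) v₁<T))
      in inj₂ (w , upS u∈S rw (≼-intro (proj₂ S⊆ u∈S) rw (<⇒≤ u<w) (λ e → contradiction e (<⇒≢ u<w)))
               , inj₁ (v₁<T , w₀ , w₁))
    ∇⇒↘ {d} {S} {v} S⊆ upS v∈ | u , u∈S , u⋖v | rv | tri> _ _ T<v₁ with ⋖⇒right⊎up u⋖v
    ...   | inj₂ u↑v = inj₂ (u , u∈S , inj₂ (T<v₁ , u↑v))
    ...   | inj₁ (e₀ , e₁) =
      let w , rw , w₀ , w₁ = below rv (≤-<-trans z≤n T<v₁)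
          T≤w₁ = s≤s⁻¹ (subst (T <_) w₁ T<v₁)
      in inj₂ (w , upS u∈S rw (≼-intro (proj₂ S⊆ u∈S) rw
                 (≤-trans (m⊓n≤n (x₁ u) T) (≤-reflexive (sym (height-≡T {w} T≤w₁))))
                 (λ _ → ≤-trans (n≤1+n _) (≤-reflexive (trans (sym e₀) w₀))))
               , inj₂ (T<v₁ , w₀ , w₁))

    length-∇-≤ : ∀ {d S} → Subset d S → UpClosed d S → (∀ {v} → rank v ≡ suc d → ¬ Special v) →
                 length (∇ S) ≤ length S
    length-∇-≤ {S = S} S⊆ upS none = injection⇒length-≤ _↘_ S (proj₁ (∇-Subset S⊆))
      (λ v∈ → [ (λ s → contradiction s (none (proj₂ (∇-Subset S⊆) v∈))) , id ]′ (∇⇒↘ S⊆ upS v∈))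
      (λ _ _ → ↘-injective)

    length-∇-≤-suc : ∀ {d S} → Subset d S → UpClosed d S → length (∇ S) ≤ suc (length S)
    length-∇-≤-suc {d} {S} S⊆ upS = ≤-trans
      (injection⇒length-≤ _↘?_ (nothing ∷ map just S) (proj₁ (∇-Subset S⊆)) total injective)
      (s≤s (≤-reflexive (length-map just S)))
      where
      -- `nothing` is the one spare slot, for the special point.
      _↘?_ : Carrier → Maybe Carrier → Set
      v ↘? nothing = Special v
      v ↘? just w  = v ↘ w

      total : ∀ {v} → v ∈ ∇ S → ∃ λ w → w ∈ nothing ∷ map just S × v ↘? w
      total v∈ with ∇⇒↘ S⊆ upS v∈
      ... | inj₁ s              = nothing , here refl , s
      ... | inj₂ (w , w∈S , v↘w) = just w , there (∈-map⁺ just w∈S) , v↘w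

      injective : ∀ {v v′ w} → v ∈ ∇ S → v′ ∈ ∇ S → v ↘? w → v′ ↘? w → v ≡ v′
      injective {w = nothing} v∈ v′∈ = Special-unique (proj₂ (∇-Subset S⊆) v∈) (proj₂ (∇-Subset S⊆) v′∈)
      injective {w = just _}  _  _   = ↘-injective

  -- Q is filled starting from whichever of its two walls appears first: T = a₁ starts at the
  -- inner wall (rank b₀ + a₁ - 1), T = b₁ at the outer one (rank b₁ - 1).
  module _ {T : ℕ} (threshold : (T ≡ a₁ × b₀ + a₁ ≤ b₁) ⊎ (T ≡ b₁ × b₁ ≤ b₀ + a₁)) where
    open Order T

    a₁≤T : a₁ ≤ T
    a₁≤T = [ (λ (e , _) → ≤-reflexive (sym e)) , (λ (e , _) → ≤-trans a₁≤b₁ (≤-reflexive (sym e))) ]′ threshold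

    height-<⇒∈ : ∀ {d S u w} → Subset d S → UpClosed d S → u ∈ S → rank w ≡ d → x₁ u < x₁ w → x₁ w < T → w ∈ S
    height-<⇒∈ {u = u} {w} S⊆ upS u∈S rw u₁<w₁ w₁<T =
      upS u∈S rw (≼-intro (proj₂ S⊆ u∈S) rw (<⇒≤ u<w) (λ e → contradiction e (<⇒≢ u<w)))
      where
      u<w : height u < height w
      u<w = ≤-<-trans (m⊓n≤m (x₁ u) T) (⊓-pres-m< u₁<w₁ (<-trans u₁<w₁ w₁<T))

    no-special-T≡a₁ : ∀ {d v} → T ≡ a₁ → b₀ + a₁ ≤ suc d → rank v ≡ suc d → ¬ Special v
    no-special-T≡a₁ {v = v} refl corner rv (inj₁ v₁≡T) = <⇒≱ (x₀<b₀ v (≤-reflexive (sym v₁≡T)))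
      (+-cancelʳ-≤ a₁ b₀ (x₀ v) (≤-trans corner (≤-reflexive (trans (sym (sum rv)) (cong (x₀ v +_) v₁≡T)))))
    no-special-T≡a₁ {v = v} refl corner rv (inj₂ (v₀≡0 , v₁<T)) = <⇒≱ v₁<T
      (≤-trans (m≤n+m a₁ b₀) (≤-trans corner (≤-reflexive (trans (sym (sum rv)) (cong (_+ x₁ v) v₀≡0)))))

    no-special-T≡b₁ : ∀ {d v} → T ≡ b₁ → b₁ ≤ suc d → rank v ≡ suc d → ¬ Special v
    no-special-T≡b₁ {v = v} refl _ _ (inj₁ v₁≡T) = <-irrefl v₁≡T (x₁<b₁ v)
    no-special-T≡b₁ {v = v} refl b₁≤ rv (inj₂ (v₀≡0 , _)) = contradiction v₀≡0 (m<n⇒n≢0 (x₀-pos v rv b₁≤))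

    no-walls : ∀ {d A S} → suc d < b₁ → suc d < b₀ + a₁ → Subset d A → Subset d S → UpClosed d S →
               length S ≡ length A → length (∇ S) ≤ length (∇ A)
    no-walls {A = []}    {[]}    _ _ _ _ _ _ = ≤-refl
    no-walls {A = m ∷ _} {S} d<b₁ d<corner A⊆ S⊆ upS ∣S∣≡∣A∣ = ≤-trans (length-∇-≤-suc S⊆ upS)
      (≤-trans (s≤s (≤-reflexive ∣S∣≡∣A∣)) (length-<-∇ d<b₁ d<corner A⊆ (here refl)))

    full : ∀ {d A S} → (∀ v → rank v ≡ d → ¬ v ∉ A) → Subset d S → length (∇ S) ≤ length (∇ A)
    full {A = A} none S⊆ = length-∇-mono λ {v} v∈S → decidable-stable (v ∈? A) (none v (proj₂ S⊆ v∈S))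

    one-part : ∀ {d A S} → b₁ ≤ suc d → suc d < b₀ + a₁ → Subset d A → Subset d S → UpClosed d S →
               length S ≡ length A → length (∇ S) ≤ length (∇ A)
    one-part {d} {A} {S} b₁≤ d<corner A⊆ S⊆ upS ∣S∣≡∣A∣ with search (λ v → ¬? (v ∈? A)) d
    ... | inj₂ none = full none S⊆
    ... | inj₁ (m , rm , m∉A) = ≤-trans (length-∇-≤ S⊆ upS (no-special-T≡b₁ T≡b₁ b₁≤))
      (≤-trans (≤-reflexive ∣S∣≡∣A∣) (routing⇒length-≤ (proj₁ A⊆)
        (routing-around-single m rm d<corner λ v∈A → proj₂ A⊆ v∈A , λ { refl → m∉A v∈A })))
      where
      T≡b₁ : T ≡ b₁
      T≡b₁ = [ (λ (_ , corner≤b₁) → contradiction (≤-trans corner≤b₁ b₁≤) (<⇒≱ d<corner)) , proj₁ ]′ threshold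

    module _ {d : ℕ} (corner : b₀ + a₁ ≤ suc d) {A S : List Carrier}
      (A⊆ : Subset d A) (S⊆ : Subset d S) (upS : UpClosed d S) (∣S∣≡∣A∣ : length S ≡ length A) where
      open TwoParts corner

      -- Without outer walls Q can go up and P right, so no set shrinks. Segments do not grow
      -- either, because the filling starts at the inner wall.
      inner-walls-only : suc d < b₁ → length (∇ S) ≤ length (∇ A)
      inner-walls-only d<b₁ = ≤-trans (length-∇-≤ S⊆ upS (no-special-T≡a₁ T≡a₁ corner))
        (≤-trans (≤-reflexive ∣S∣≡∣A∣) (routing⇒length-≤ (proj₁ A⊆) (combine (proj₂ A⊆)
          (routing-up λ {v} (v∈A , v∈Q) → inj₂ (x₀<b₀ v v∈Q ,
            ≤-<-trans (s≤s (≤-trans (m≤n+m _ _) (≤-reflexive (sum (proj₂ A⊆ v∈A))))) d<b₁))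
          (routing-right-P (<-≤-trans d<b₁ b₁≤a₀) (proj₂ A⊆)))))
        where
        T≡a₁ : T ≡ a₁
        T≡a₁ = [ proj₁ , (λ (_ , b₁≤corner) → contradiction (≤-trans b₁≤corner corner) (<⇒≱ d<b₁)) ]′ threshold

      module _ (b₁≤ : b₁ ≤ suc d) where

        ∣∇S∣≤∣A∣ : length (∇ S) ≤ length A
        ∣∇S∣≤∣A∣ = ≤-trans (length-∇-≤ S⊆ upS no-special) (≤-reflexive ∣S∣≡∣A∣)
          where
          no-special : ∀ {v} → rank v ≡ suc d → ¬ Special v
          no-special = [ (λ (e , _) → no-special-T≡a₁ e corner) , (λ (e , _) → no-special-T≡b₁ e b₁≤) ]′ threshold

        part-Q-upClosed : UpClosed d part-Q
        part-Q-upClosed {q} {w} q∈ rw q≼w with a₁ ≤? x₁ w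
        ... | yes w∈Q = ∈-part-Q⁺ rw w∈Q
        ... | no  w∉Q = contradiction (≤-trans (⊓-glb (proj₂ (∈-part-Q⁻ q∈)) a₁≤T)
          (≤-trans (≼⇒height-≤ {q} {w} q≼w) (m⊓n≤m (x₁ w) T))) w∉Q

        -- Q is up-closed, so a segment at least as long contains it, and containing a closed
        -- nonempty part makes the shadow smaller.
        ∣∇S∣<∣A∣ : ∀ q → rank q ≡ d → a₁ ≤ x₁ q → length part-Q ≤ length A → length (∇ S) < length A
        ∣∇S∣<∣A∣ q rq q∈Q ∣Q∣≤∣A∣ = <-≤-trans
          (∇-contracts q b₁≤ S⊆ rq q∈Q
            (upClosed-⊆ (filter-Subset (λ v → a₁ ≤? x₁ v)) S⊆ part-Q-upClosed upS
              (≤-trans ∣Q∣≤∣A∣ (≤-reflexive (sym ∣S∣≡∣A∣))))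
            (λ { {u} u∈S rw (_ , e₁) (_ , f₁) v₁<a₁ → height-<⇒∈ S⊆ upS u∈S rw
              (subst (x₁ u <_) f₁ (≤-reflexive (sym e₁)))
              (<-≤-trans (subst (_< a₁) f₁ v₁<a₁) a₁≤T) }))
          (≤-reflexive ∣S∣≡∣A∣)

        private
          off : ∀ {m v} → m ∉ A → v ∈ A → rank v ≡ d × v ≢ m
          off m∉A v∈A = proj₂ A⊆ v∈A , λ { refl → m∉A v∈A }

          ⊆A : ∀ {P : Carrier → Set} → (∀ v → rank v ≡ d → ¬ (P v × v ∉ A)) → ∀ {v} → rank v ≡ d → P v → v ∈ A
          ⊆A none {v} rv Pv = decidable-stable (v ∈? A) λ v∉A → none v rv (Pv , v∉A)

        -- Only containing all of a nonempty Q can make `A` shrink, and then by one at most; but `A`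
        -- is then long enough for `S` to contain Q and shrink as well.
        P-routable : Routing (λ v → v ∈ A × x₁ v < a₁) → length (∇ S) ≤ length (∇ A)
        P-routable rP with search (λ v → (a₁ ≤? x₁ v) ×-dec ¬? (v ∈? A)) d
        ... | inj₁ (m , rm , m∈Q , m∉A) = ≤-trans ∣∇S∣≤∣A∣ (routing⇒length-≤ (proj₁ A⊆)
          (combine (proj₂ A⊆) (routing-around-Q m rm m∈Q (off m∉A)) rP))
        ... | inj₂ Q⊆A with search (λ v → a₁ ≤? x₁ v) d
        ...   | inj₂ Q-empty = ≤-trans ∣∇S∣≤∣A∣ (routing⇒length-≤ (proj₁ A⊆) (combine (proj₂ A⊆)
          (routing-up λ {v} (v∈A , v∈Q) → contradiction v∈Q (Q-empty v (proj₂ A⊆ v∈A))) rP))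
        ...   | inj₁ (q , rq , q∈Q) = s≤s⁻¹ (≤-trans
          (∣∇S∣<∣A∣ q rq q∈Q (⊆⇒length-≤ (proj₁ (filter-Subset (λ v → a₁ ≤? x₁ v)))
            λ v∈ → let rv , v∈Q = ∈-part-Q⁻ v∈ in ⊆A Q⊆A rv v∈Q))
          (routing-off⇒length-≤ q (proj₁ A⊆) (combine (proj₂ A⊆ ∘ proj₁)
            (routing-around-Q q rq q∈Q λ (v∈A , v≢q) → proj₂ A⊆ v∈A , v≢q)
            (restrict (λ ((v∈A , _) , v∈P) → v∈A , v∈P) rP))))

        -- A proper subset `A` containing P misses a point of Q and shrinks by at most one. As Q is
        -- no larger than P, `S` contains Q and shrinks too.
        P-contained : a₀ ≤ suc d → (∀ v → rank v ≡ d → ¬ (x₁ v < a₁ × v ∉ A)) → length (∇ S) ≤ length (∇ A)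
        P-contained a₀≤ P⊆A with search (λ v → ¬? (v ∈? A)) d
        ... | inj₂ none = full none S⊆
        ... | inj₁ (m , rm , m∉A) with a₁ ≤? x₁ m
        ...   | no  m∉Q = contradiction (≰⇒> m∉Q , m∉A) (P⊆A m rm)
        ...   | yes m∈Q =
          -- The shift of `m` supplies a point of P; leaving it out makes P routable at the cost of
          -- one.
          let p , p∈ , _ = shift a₀≤ b≤a rm m∈Q
              rp , p∈P = ∈-part-P⁻ p∈
          in s≤s⁻¹ (≤-trans
            (∣∇S∣<∣A∣ m rm m∈Q (≤-trans (part-Q≤part-P a₀≤ b≤a)
              (⊆⇒length-≤ (proj₁ (filter-Subset (λ v → x₁ v <? a₁)))
                λ v∈ → let rv , v∈P = ∈-part-P⁻ v∈ in ⊆A P⊆A rv v∈P)))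
            (routing-off⇒length-≤ p (proj₁ A⊆) (combine (proj₂ A⊆ ∘ proj₁)
              (routing-around-Q m rm m∈Q (off m∉A ∘ proj₁))
              (routing-around-P p rp p∈P λ (v∈A , v≢p) → proj₂ A⊆ v∈A , v≢p))))

        two-parts : length (∇ S) ≤ length (∇ A)
        two-parts with a₀ ≤? suc d | search (λ v → (x₁ v <? a₁) ×-dec ¬? (v ∈? A)) d
        ... | no  a₀≰ | _ = P-routable (routing-right-P (≰⇒> a₀≰) (proj₂ A⊆))
        ... | yes a₀≤ | inj₁ (m , rm , m∈P , m∉A) = P-routable (routing-around-P m rm m∈P (off m∉A))
        ... | yes a₀≤ | inj₂ P⊆A = P-contained a₀≤ P⊆A

    upClosed-minimal : ∀ {d A S} → Subset d A → Subset d S → UpClosed d S →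
                       length S ≡ length A → length (∇ S) ≤ length (∇ A)
    upClosed-minimal {d} A⊆ S⊆ upS e with b₀ + a₁ ≤? suc d | b₁ ≤? suc d
    ... | yes corner | yes b₁≤ = two-parts corner A⊆ S⊆ upS e b₁≤
    ... | yes corner | no  b₁≰ = inner-walls-only corner A⊆ S⊆ upS e (≰⇒> b₁≰)
    ... | no  ¬corner | yes b₁≤ = one-part b₁≤ (≰⇒> ¬corner) A⊆ S⊆ upS e
    ... | no  ¬corner | no  b₁≰ = no-walls (≰⇒> b₁≰) (≰⇒> ¬corner) A⊆ S⊆ upS e

    macaulay-with : Macaulay R
    macaulay-with = _≼_ , isDTO , λ d A A! rankA →
      let A⊆ = A! , All.lookup rankA
          S⊆ = Seg-Subset d (length A)
          upS = Seg-upClosed d (length A)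
      in upClosed-minimal A⊆ S⊆ upS (Seg-length d (length A) (Subset⇒length-≤ A⊆)) ,
         upClosed⇒Seg (∇-Subset S⊆) (∇-upClosed S⊆ upS)

  macaulay : Macaulay R
  macaulay with ≤-total (b₀ + a₁) b₁
  ... | inj₁ corner≤b₁ = macaulay-with (inj₁ (refl , corner≤b₁))
  ... | inj₂ b₁≤corner = macaulay-with (inj₂ (refl , b₁≤corner))

-- The fiber product and the assembly of the cases

fiberProduct-Realizes : ∀ a₀ a₁ b₀ b₁ →
  Realizes (toRankedPoset (fiberProduct (clementsLindström a₀ a₁) (clementsLindström b₀ b₁)
    (clementsLindström (a₀ ⊓ b₀) (a₁ ⊓ b₁)) (clementsLindström-∩ a₀ a₁ b₀ b₁))) a₀ a₁ b₀ b₁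
fiberProduct-Realizes a₀ a₁ b₀ b₁ = record
  { x₀               = proj₁ ∘ value
  ; x₁               = proj₂ ∘ value
  ; coords-injective = λ e₀ e₁ → value-injective (cong₂ _,_ e₀ e₁)
  ; region           = λ { (x , [ m ]) → recompute (mem? X x) m }
  ; point            = λ {i} {j} m → ((i , j) , [ m ]) , refl , refl
  ; ⊑⁺               = _,_
  ; ⊑⁻               = id
  ; rank-sum         = λ _ → refl
  }
  where
  open FiniteOrderIdeal
  X : FiniteOrderIdeal
  X = fiberProduct (clementsLindström a₀ a₁) (clementsLindström b₀ b₁)
        (clementsLindström (a₀ ⊓ b₀) (a₁ ⊓ b₁)) (clementsLindström-∩ a₀ a₁ b₀ b₁)

Balanced Condition : (a₀ a₁ b₀ b₁ : ℕ) → Set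
Balanced a₀ a₁ b₀ b₁ = a₀ ≡ b₁ ⊎ (b₁ < a₀ × b₁ + b₀ ≤ a₀ + a₁) ⊎ (a₀ < b₁ × a₀ + a₁ ≤ b₀ + b₁)
Condition a₀ a₁ b₀ b₁ =
  (a₀ ≤ b₀ × a₁ ≤ b₁) ⊎ (b₀ ≤ a₀ × b₁ ≤ a₁)
  ⊎ (b₀ < a₀ × a₁ < b₁ × Balanced a₀ a₁ b₀ b₁)
  ⊎ (a₀ < b₀ × b₁ < a₁ × Balanced b₀ b₁ a₀ a₁)

module _ {R : FiniteRankedPoset} {a₀ a₁ b₀ b₁ : ℕ} where

  -- A rectangle is a crossing whose other rectangle is empty: Q of width 0, or P of height 0 before
  -- reflection. The longer side decides which one satisfies the condition that Q closes no later
  -- than P.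
  contained⇒macaulay : Realizes R a₀ a₁ b₀ b₁ → b₀ ≤ a₀ → b₁ ≤ a₁ → Macaulay R
  contained⇒macaulay real b₀≤a₀ b₁≤a₁ with ≤-total a₁ a₀
  ... | inj₁ a₁≤a₀ = IsMacaulay.macaulay degenerate z≤n ≤-refl a₁≤a₀ (m≤n+m a₁ a₀)
    where
    degenerate : Realizes R a₀ a₁ 0 a₁
    degenerate = record
      { Realizes real
      ; region = λ v → inj₁ ([ id , (λ (p , q) → <-≤-trans p b₀≤a₀ , <-≤-trans q b₁≤a₁) ]′ (Realizes.region real v))
      ; point  = λ { (inj₁ r) → Realizes.point real (inj₁ r) }
      }
  ... | inj₂ a₀≤a₁ = IsMacaulay.macaulay (transpose degenerate) z≤n ≤-refl a₀≤a₁ (m≤n+m a₀ a₁)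
    where
    degenerate : Realizes R a₀ 0 a₀ a₁
    degenerate = record
      { Realizes real
      ; region = λ v → inj₂ ([ id , (λ (p , q) → <-≤-trans p b₀≤a₀ , <-≤-trans q b₁≤a₁) ]′ (Realizes.region real v))
      ; point  = λ { (inj₂ r) → Realizes.point real (inj₁ r) }
      }

  crossing⇒macaulay : Realizes R a₀ a₁ b₀ b₁ → b₀ < a₀ → a₁ < b₁ →
    Balanced a₀ a₁ b₀ b₁ → Macaulay R
  crossing⇒macaulay real b₀<a₀ a₁<b₁ = [ equal , [ (λ (p , q) → wide (<⇒≤ p) q) , (λ (p , q) → tall (<⇒≤ p) q) ]′ ]′
    where
    wide : b₁ ≤ a₀ → b₁ + b₀ ≤ a₀ + a₁ → Macaulay R
    wide b₁≤a₀ b≤a = IsMacaulay.macaulay real (<⇒≤ b₀<a₀) (<⇒≤ a₁<b₁) b₁≤a₀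
      (≤-trans (≤-reflexive (+-comm b₀ b₁)) b≤a)

    tall : a₀ ≤ b₁ → a₀ + a₁ ≤ b₀ + b₁ → Macaulay R
    tall a₀≤b₁ a≤b = IsMacaulay.macaulay (transpose real) (<⇒≤ a₁<b₁) (<⇒≤ b₀<a₀) a₀≤b₁
      (≤-trans (≤-reflexive (+-comm a₁ a₀)) (≤-trans a≤b (≤-reflexive (+-comm b₀ b₁))))

    -- Both outer walls appear in the same rank, so either part may be filled first; the one that is
    -- not larger is taken.
    equal : a₀ ≡ b₁ → Macaulay R
    equal refl with ≤-total (b₁ + b₀) (a₀ + a₁)
    ... | inj₁ b≤a = wide ≤-refl b≤a
    ... | inj₂ a≤b = tall ≤-refl (≤-trans a≤b (≤-reflexive (+-comm b₁ b₀)))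

  macaulay⇒crossing : Realizes R a₀ a₁ b₀ b₁ → 0 < a₁ → 0 < b₀ → b₀ < a₀ → a₁ < b₁ → Macaulay R →
    Balanced a₀ a₁ b₀ b₁
  macaulay⇒crossing real 0<a₁ 0<b₀ b₀<a₀ a₁<b₁ (_ , isDTO , isMac) with <-cmp a₀ b₁
  ... | tri≈ _ a₀≡b₁ _ = inj₁ a₀≡b₁
  ... | tri> _ _ b₁<a₀ with b₁ + b₀ ≤? a₀ + a₁
  ...   | yes b≤a = inj₂ (inj₁ (b₁<a₀ , b≤a))
  ...   | no  b≰a = contradiction isMac (NotMacaulay.impossible real b₀<a₀ a₁<b₁ b₁<a₀
    (<-≤-trans (≰⇒> b≰a) (≤-reflexive (+-comm b₁ b₀))) 0<a₁ isDTO)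
  macaulay⇒crossing real 0<a₁ 0<b₀ b₀<a₀ a₁<b₁ (_ , isDTO , isMac) | tri< a₀<b₁ _ _ with a₀ + a₁ ≤? b₀ + b₁
  ...   | yes a≤b = inj₂ (inj₂ (a₀<b₁ , a≤b))
  ...   | no  a≰b = contradiction isMac (NotMacaulay.impossible (transpose real) a₁<b₁ b₀<a₀ a₀<b₁
    (≤-<-trans (≤-reflexive (+-comm b₁ b₀)) (<-≤-trans (≰⇒> a≰b) (≤-reflexive (+-comm a₀ a₁)))) 0<b₀ isDTO)

module _ {R : FiniteRankedPoset} {a₀ a₁ b₀ b₁ : ℕ} (real : Realizes R a₀ a₁ b₀ b₁) where

  macaulay⇒condition : 0 < a₀ → 0 < a₁ → 0 < b₀ → 0 < b₁ → Macaulay R → Condition a₀ a₁ b₀ b₁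
  macaulay⇒condition 0<a₀ 0<a₁ 0<b₀ 0<b₁ mac with a₀ ≤? b₀ | a₁ ≤? b₁
  ... | yes a₀≤b₀ | yes a₁≤b₁ = inj₁ (a₀≤b₀ , a₁≤b₁)
  ... | no  a₀≰b₀ | no  a₁≰b₁ = inj₂ (inj₁ (≰⇒≥ a₀≰b₀ , ≰⇒≥ a₁≰b₁))
  ... | no  a₀≰b₀ | yes a₁≤b₁ with m≤n⇒m<n∨m≡n a₁≤b₁
  ...   | inj₂ a₁≡b₁ = inj₂ (inj₁ (≰⇒≥ a₀≰b₀ , ≤-reflexive (sym a₁≡b₁)))
  ...   | inj₁ a₁<b₁ = inj₂ (inj₂ (inj₁ (≰⇒> a₀≰b₀ , a₁<b₁ ,
    macaulay⇒crossing real 0<a₁ 0<b₀ (≰⇒> a₀≰b₀) a₁<b₁ mac)))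
  macaulay⇒condition 0<a₀ 0<a₁ 0<b₀ 0<b₁ mac | yes a₀≤b₀ | no a₁≰b₁ with m≤n⇒m<n∨m≡n a₀≤b₀
  ...   | inj₂ a₀≡b₀ = inj₂ (inj₁ (≤-reflexive (sym a₀≡b₀) , ≰⇒≥ a₁≰b₁))
  ...   | inj₁ a₀<b₀ = inj₂ (inj₂ (inj₂ (a₀<b₀ , ≰⇒> a₁≰b₁ ,
    macaulay⇒crossing (exchange real) 0<b₁ 0<a₀ a₀<b₀ (≰⇒> a₁≰b₁) mac)))

  condition⇒macaulay : Condition a₀ a₁ b₀ b₁ → Macaulay R
  condition⇒macaulay (inj₁ (a₀≤b₀ , a₁≤b₁))                       = contained⇒macaulay (exchange real) a₀≤b₀ a₁≤b₁
  condition⇒macaulay (inj₂ (inj₁ (b₀≤a₀ , b₁≤a₁)))                = contained⇒macaulay real b₀≤a₀ b₁≤a₁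
  condition⇒macaulay (inj₂ (inj₂ (inj₁ (b₀<a₀ , a₁<b₁ , c))))     = crossing⇒macaulay real b₀<a₀ a₁<b₁ c
  condition⇒macaulay (inj₂ (inj₂ (inj₂ (a₀<b₀ , b₁<a₁ , c))))     = crossing⇒macaulay (exchange real) a₀<b₀ b₁<a₁ c

theorem3 : (a₀ a₁ b₀ b₁ : ℕ) .{{_ : NonZero a₀}} .{{_ : NonZero a₁}} .{{_ : NonZero b₀}} .{{_ : NonZero b₁}} →
    Macaulay (toRankedPoset (fiberProduct
    (clementsLindström a₀ a₁)
    (clementsLindström b₀ b₁)
    (clementsLindström (a₀ ⊓ b₀) (a₁ ⊓ b₁))
    (clementsLindström-∩ a₀ a₁ b₀ b₁)))
    ⇔
    ( (a₀ ≤ b₀ × a₁ ≤ b₁)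
    ⊎ (b₀ ≤ a₀ × b₁ ≤ a₁)
    ⊎ (b₀ < a₀ × a₁ < b₁ ×
    ( a₀ ≡ b₁
    ⊎ (b₁ < a₀ × b₁ + b₀ ≤ a₀ + a₁)
    ⊎ (a₀ < b₁ × a₀ + a₁ ≤ b₀ + b₁)))
    ⊎ (a₀ < b₀ × b₁ < a₁ ×
    ( b₀ ≡ a₁
    ⊎ (a₁ < b₀ × a₁ + a₀ ≤ b₀ + b₁)
    ⊎ (b₀ < a₁ × b₀ + b₁ ≤ a₀ + a₁))) )
theorem3 a₀ a₁ b₀ b₁ = mk⇔
  (macaulay⇒condition real (>-nonZero⁻¹ a₀) (>-nonZero⁻¹ a₁) (>-nonZero⁻¹ b₀) (>-nonZero⁻¹ b₁))
  (condition⇒macaulay real)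
  where
  real = fiberProduct-Realizes a₀ a₁ b₀ b₁
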